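{- Let $d,k$ be positive integers. The following are equivalent: (1) There exists an infinite sequence $X=n_0n_1n_2\cdots$ of positive integers (with no computability restriction) such that $X\in \mathrm{ENSH}^d_k$, i.e. $\mathrm{ENSH}^d_k(n_0\cdots n_{r-1})$ holds for every $r>0$. (2) There exists a $\mathsf{VWI}(d,k)$-instance $c:d^{<\omega}\to k$ that does not admit a $c$-computable $\mathsf{VWI}(d,k)$-solution.
   Context: Identify $d$ with $\{0,\dots,d-1\}$ and $k$ with $\{0,\dots,k-1\}$; $d^n$ is the set of words of length $n$ over $d$, and $d^{<\omega}$ the set of all finite words over $d$. Variable words. A variable word over $d$ is a finite or infinite sequence $v$ with entries in $\{0,\dots,d-1\}\cup\{x_0,x_1,\dots\}$ (the $x_m$ are variables). $P_{x_m}(v)=\{t: v(t)=x_m\}$; $x_m$ occurs in $v$ if $P_{x_m}(v)\neq\emptyset$, and then its first occurrence is $\min P_{x_m}(v)$. An $n$-variable word ($n\in\omega$ or $n=\omega$) is a variable word (infinite if $n=\omega$) in which exactly $n$ variables occur; it is assumed that whenever $x_m,x_{m'}$ both occur and $m<m'$, the first occurrence of $x_m$ is smaller than that of $x_{m'}$. Let $x_{m_0},x_{m_1},\dots$ with $m_0<m_1<\cdots$ be the variables occurring in an $n$-variable word $v$. For $\vec a\in d^{\hat n}$, $v(\vec a)$ is the word over $d$ obtained by replacing $x_{m_j}$ by $\vec a(j)$ for all $j<\min\{n,\hat n\}$ and then truncating just before the first occurrence of $x_{m_{\hat n}}$ (no truncation if $\hat n\ge n$). $\mathsf{VWI}(d,k)$.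 An instance is a coloring $c:d^{<\omega}\to k$. A solution of $c$ is an $\omega$-variable word $v$ over $d$ such that $c$ is constant on $\{v(\vec a):\vec a\in d^{<\omega}\}$. A solution is $c$-computable if it is computable relative to $c$ as an oracle. $\mathrm{ENSH}$. Let $n_0,\dots,n_{r-1}$ be a finite sequence of positive integers, $N=n_0+\cdots+n_{r-1}$, and for $s\le r-1$ let $N_s=\{n_0+\cdots+n_{s-1},\dots,n_0+\cdots+n_s-1\}$ (so $N_0=\{0,\dots,n_0-1\}$). Let $f:d^N\to k$. The sequence $n_0\cdots n_{r-1}$ is sectionally-homogeneous for $f$ if there exist $s\le r-1$ and an $n_s$-variable word $v$ over $d$ of length $N$ such that the set of first occurrences of the variables occurring in $v$ is exactly $N_s$, and $f$ is constant on $\{v(\vec a):\vec a\in d^{n_s}\}$. $\mathrm{ENSH}^d_k(n_0\cdots n_{r-1})$ holds if there exists $f:d^N\to k$ such that $n_0\cdots n_{r-1}$ is not sectionally-homogeneous for $f$. $\mathrm{ENSH}^d_k$ also denotes the set of infinite sequences of positive integers all of whose nonempty finite initial segments satisfy $\mathrm{ENSH}^d_k(\cdot)$. -}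

module Defs where

open import Data.Fin.Base using (Fin; toℕ; fromℕ<)
open import Data.List.Base as List using (List; []; _∷_; length; sum; take; applyUpTo)
open import Data.Nat.Base using (ℕ; suc; _+_; _*_; _≤_; _<_)
open import Data.Nat.Properties using (≰⇒>; m≤n⇒m<n∨m≡n; <-trans)
open import Data.Product.Base using (∃; _×_; _,_; proj₁; proj₂)
open import Data.Sum.Base using (inj₁; inj₂)
open import Data.Vec.Base as Vec using (Vec; []; _∷_)
open import Function.Bundles using (_⇔_)
open import Relation.Binary.PropositionalEquality using (_≡_; _≢_; refl; cong; trans; subst)
open import Relation.Nullary using (¬_)

data Symbol (d : ℕ) : Set where
  letter : Fin d → Symbol d
  x      : ℕ → Symbol d

data Extent : Set where
  fin : ℕ → Extent
  ω   : Extent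

Index : Extent → Set
Index (fin n) = Fin n
Index ω       = ℕ

val : ∀ {κ} → Index κ → ℕ
val {fin n} = toℕ
val {ω} n   = n

-- t = min P_{x_m}(v)
IsFirstOccurrence : ∀ {d ℓ} → (Index ℓ → Symbol d) → ℕ → Index ℓ → Set
IsFirstOccurrence {ℓ = ℓ} v m t =
  v t ≡ x m × (∀ s → val {ℓ} s < val {ℓ} t → v s ≢ x m)

-- An n-variable word of length ℓ.  All fields other than word are determined
-- by word: var j is the index m_j of the j-th variable occurring in it, and
-- first j is the first occurrence of that variable.
record VariableWord (d : ℕ) (n ℓ : Extent) : Set where
  field
    word       : Index ℓ → Symbol d
    var        : Index n → ℕ
    first      : Index n → Index ℓ
    var-mono   : ∀ {i j} → val {n} i < val {n} j → var i < var j
    first-occ  : ∀ j → IsFirstOccurrence {ℓ = ℓ} word (var j) (first j)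
    occurring  : ∀ {t m} → word t ≡ x m → ∃ λ j → m ≡ var j
    first-mono : ∀ {i j} → val {n} i < val {n} j → val {ℓ} (first i) < val {ℓ} (first j)

replace : ∀ {d} (s : Symbol d) → (∀ m → s ≡ x m → Fin d) → Fin d
replace (letter b) σ = b
replace (x m)      σ = σ m refl

infix 8 _⟨_⟩ _⟪_⟫

-- v(a) for a ∈ d^n and v a finite n-variable word; nothing is truncated here.
_⟨_⟩ : ∀ {d n N} → VariableWord d (fin n) (fin N) → Vec (Fin d) n → Vec (Fin d) N
v ⟨ a ⟩ = Vec.tabulate λ t →
  replace (word t) λ m eq → Vec.lookup a (proj₁ (occurring eq))
  where open VariableWord v

-- A variable met before the first occurrence of x_{m_n̂} is x_{m_j} with j < n̂.
index-< : ∀ {d} (v : VariableWord d ω ω) → let open VariableWord v in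
          ∀ {n̂ t m} → t < first n̂ → (eq : word t ≡ x m) → proj₁ (occurring eq) < n̂
index-< v {n̂} {t} t<first eq = ≰⇒> λ n̂≤j →
  proj₂ (first-occ j) t (<-first n̂≤j) (trans eq (cong x (proj₂ (occurring eq))))
  where
  open VariableWord v
  j = proj₁ (occurring eq)
  <-first : n̂ ≤ j → t < first j
  <-first n̂≤j with m≤n⇒m<n∨m≡n n̂≤j
  ... | inj₁ n̂<j  = <-trans t<first (first-mono n̂<j)
  ... | inj₂ n̂≡j = subst (λ i → t < first i) n̂≡j t<first

-- v(a) for a ∈ d^{<ω} and v an ω-variable word: with n̂ the length of a, the
-- result is truncated just before the first occurrence of x_{m_n̂}.
_⟪_⟫ : ∀ {d} → VariableWord d ω ω → List (Fin d) → List (Fin d)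
v ⟪ a ⟫ = List.tabulate {n = first (length a)} λ t →
  replace (word (toℕ t)) λ m eq →
    List.lookup a (fromℕ< (index-< v (toℕ<n t) eq))
  where
  open VariableWord v
  open import Data.Fin.Properties using (toℕ<n)

Constant : ∀ {A B : Set} → (A → B) → Set
Constant f = ∀ a b → f a ≡ f b

InSection : (ns : List ℕ) → Fin (length ns) → ℕ → Set
InSection ns s t = sum (take (toℕ s) ns) ≤ t × t < sum (take (suc (toℕ s)) ns)

SectionallyHomogeneous : ∀ {d k} (ns : List ℕ) → (Vec (Fin d) (sum ns) → Fin k) → Set
SectionallyHomogeneous {d} ns f =
  ∃ λ (s : Fin (length ns)) →
  ∃ λ (v : VariableWord d (fin (List.lookup ns s)) (fin (sum ns))) →
    (∀ t → (∃ λ j → VariableWord.first v j ≡ t) ⇔ InSection ns s (toℕ t)) ×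
    Constant (λ a → f (v ⟨ a ⟩))

ENSH : (d k : ℕ) → List ℕ → Set
ENSH d k ns = ∃ λ (f : Vec (Fin d) (sum ns) → Fin k) → ¬ SectionallyHomogeneous ns f

ENSH∞ : (d k : ℕ) → (ℕ → ℕ) → Set
ENSH∞ d k X = (∀ i → 0 < X i) × (∀ r → 0 < r → ENSH d k (applyUpTo X r))

-- μ-recursive functions with an oracle, by arity.
data Rec : ℕ → Set where
  zeroᴿ  : Rec 0
  sucᴿ   : Rec 1
  proj   : ∀ {n} → Fin n → Rec n
  oracle : Rec 1
  comp   : ∀ {m n} → Rec m → Vec (Rec n) m → Rec n
  prec   : ∀ {n} → Rec n → Rec (suc (suc n)) → Rec (suc n)
  μ      : ∀ {n} → Rec (suc n) → Rec n

-- Bijective base-d numeration, least significant letter first: for d ≥ 1 this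
-- is a bijection between finite words and ℕ, so the oracle below is a total
-- single-valued function on ℕ.
codeWord : ∀ {d} → List (Fin d) → ℕ
codeWord         []      = 0
codeWord {d = d} (b ∷ w) = suc (toℕ b + d * codeWord w)

codeSymbol : ∀ {d} → Symbol d → ℕ
codeSymbol         (letter b) = toℕ b
codeSymbol {d = d} (x m)      = d + m

infix 4 _⊢_·_⇓_

-- c ⊢ p · xs ⇓ y : with oracle c, the program p halts on xs with output y.
data _⊢_·_⇓_ {d k} (c : List (Fin d) → Fin k) : ∀ {n} → Rec n → Vec ℕ n → ℕ → Set where
  ⇓zero   : c ⊢ zeroᴿ · [] ⇓ 0
  ⇓suc    : ∀ {n} → c ⊢ sucᴿ · n ∷ [] ⇓ suc n
  ⇓proj   : ∀ {n} (i : Fin n) {xs} → c ⊢ proj i · xs ⇓ Vec.lookup xs i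
  ⇓oracle : ∀ w → c ⊢ oracle · codeWord w ∷ [] ⇓ toℕ (c w)
  ⇓comp   : ∀ {m n} {f : Rec m} {gs : Vec (Rec n) m} {xs ys z} →
            (∀ i → c ⊢ Vec.lookup gs i · xs ⇓ Vec.lookup ys i) →
            c ⊢ f · ys ⇓ z → c ⊢ comp f gs · xs ⇓ z
  ⇓prec-0 : ∀ {n} {f : Rec n} {g xs y} →
            c ⊢ f · xs ⇓ y → c ⊢ prec f g · 0 ∷ xs ⇓ y
  ⇓prec-s : ∀ {n} {f : Rec n} {g xs i y z} →
            c ⊢ prec f g · i ∷ xs ⇓ y → c ⊢ g · i ∷ y ∷ xs ⇓ z →
            c ⊢ prec f g · suc i ∷ xs ⇓ z
  ⇓μ      : ∀ {n} {f : Rec (suc n)} {xs i} →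
            (∀ j → j < i → ∃ λ y → c ⊢ f · j ∷ xs ⇓ suc y) →
            c ⊢ f · i ∷ xs ⇓ 0 → c ⊢ μ f · xs ⇓ i

_ComputableFrom_ : ∀ {d k} → (ℕ → Symbol d) → (List (Fin d) → Fin k) → Set
v ComputableFrom c = ∃ λ (p : Rec 1) → ∀ t → c ⊢ p · t ∷ [] ⇓ codeSymbol (v t)

IsSolution : ∀ {d k} → (List (Fin d) → Fin k) → VariableWord d ω ω → Set
IsSolution c v = Constant (λ a → c (v ⟪ a ⟫))

HasComputableSolution : ∀ {d k} → (List (Fin d) → Fin k) → Set
HasComputableSolution {d} c =
  ∃ λ (v : VariableWord d ω ω) → IsSolution c v × VariableWord.word v ComputableFrom c

{-# OPTIONS --safe #-}

-- (1) ⇒ (2).  The coloring is built by forcing.  A condition fixes it on all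
-- words below some length and fixes blocks of positions, of sizes n₀, …, n_{r-1};
-- on longer words it has to be non-constant on every variable word in which some
-- block consists of first occurrences.  Reading a word along the blocks and
-- applying the function witnessing ENSH(n₀ ⋯ n_{r-1}) does this.  Given a program
-- that outputs an ω-variable word v on some coloring admitted by the condition,
-- n_r first occurrences in v become a new block, and the coloring is frozen up to
-- the use of the computation of this part of v; then v is a solution of no
-- coloring admitted by the new condition.
--
-- (2) ⇒ (1).  Fix a word w and a color i.  If for every n some variable word
-- w x₀ ⋯ x_{n-1} τ has all its instances colored i, a solution is computed
-- greedily from c: append the next variable to the word found so far and search
-- for a continuation all of whose instances are colored i.  So for each length m
-- some n works against all w ∈ d^m and all i, and choosing n_r in this way for
-- m = n₀ + ⋯ + n_{r-1} makes c restricted to d^N a witness of ENSH for every r.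

module Submission where

open import Defs
open import Axiom.ExcludedMiddle using (ExcludedMiddle)
open import Data.Empty using (⊥-elim)
open import Data.Fin.Base using (Fin; zero; suc; toℕ; fromℕ<)
open import Data.Fin.Patterns using (0F; 1F; 2F; 3F)
open import Data.Fin.Properties using (any?; toℕ-injective; toℕ<n; toℕ-fromℕ<; nonZeroIndex)
open import Data.List.Base as List using (List; []; _∷_; _++_; [_]; _∷ʳ_; length; take; applyUpTo; upTo; allFin; concatMap; cartesianProductWith)
open import Data.List.Membership.Propositional using (_∈_; lose)
open import Data.List.Membership.Propositional.Properties using (∈-++⁺ˡ; ∈-++⁺ʳ; ∈-map⁺; ∈-allFin; ∈-upTo⁺; ∈-concatMap⁺; ∈-cartesianProductWith⁺)
open import Data.List.Properties using (applyUpTo-∷ʳ; length-applyUpTo; lookup-applyUpTo)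
open import Data.List.Relation.Unary.Any using (here; there)
open import Data.Nat.Base
open import Data.Nat.DivMod
open import Data.Nat.Divisibility using (divides-refl)
open import Data.Nat.Induction using (<-rec)
open import Data.Nat.ListAction using (sum)
open import Data.Nat.ListAction.Properties using (sum-++)
open import Data.Nat.Properties
open import Data.Nat.Tactic.RingSolver using (solve-∀)
open import Data.Product.Base using (∃; _×_; _,_; proj₁; proj₂)
open import Data.Sum.Base using (inj₁; inj₂)
open import Data.Vec.Base as Vec using (Vec; []; _∷_)
import Data.Vec.Properties as Vec
open import Function.Base using (_∘_; const; id; _$_)
open import Function.Bundles using (_⇔_; mk⇔; Equivalence)
open import Level using (0ℓ)
open import Relation.Binary.Definitions using (tri<; tri≈; tri>)
open import Relation.Binary.PropositionalEquality hiding ([_])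
open import Relation.Nullary using (¬_; yes; no)
open import Relation.Nullary.Decidable using (decidable-stable)

-- Instances of variable words

-- A total counterpart of `replace`: the assignment covers all indices, so no proof of occurrence is
-- carried along and substitutions compose.
sub : ∀ {d} → (ℕ → Fin d) → Symbol d → Fin d
sub f (letter b) = b
sub f (x m)      = f m

replace-sub : ∀ {d} (s : Symbol d) {σ} {f : ℕ → Fin d} →
              (∀ m eq → σ m eq ≡ f m) → replace s σ ≡ sub f s
replace-sub (letter b) σ≡f = refl
replace-sub (x m)      σ≡f = σ≡f m refl

tabulate-toℕ : ∀ {A : Set} {n} {F : Fin n → A} (g : ℕ → A) →
               (∀ i → F i ≡ g (toℕ i)) → List.tabulate F ≡ applyUpTo g n
tabulate-toℕ {n = zero}  g F≡g = refl
tabulate-toℕ {n = suc n} g F≡g =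
  cong₂ _∷_ (F≡g zero) (tabulate-toℕ (g ∘ suc) (F≡g ∘ suc))

-- Truncation removes all variables from the one numbered `length a` on, so `f` has to match `a`
-- only on the earlier ones.
⟪⟫-sub : ∀ {d} (v : VariableWord d ω ω) (a : List (Fin d)) (f : ℕ → Fin d) →
         let open VariableWord v in
         (∀ i → f (var (toℕ i)) ≡ List.lookup a i) →
         v ⟪ a ⟫ ≡ applyUpTo (sub f ∘ word) (first (length a))
⟪⟫-sub v a f f≡a = tabulate-toℕ _ λ t → replace-sub (word (toℕ t)) λ m eq →
  let j< = index-< v (toℕ<n t) eq in begin
  List.lookup a (fromℕ< j<)       ≡⟨ f≡a (fromℕ< j<) ⟨
  f (var (toℕ (fromℕ< j<)))       ≡⟨ cong (f ∘ var) (toℕ-fromℕ< j<) ⟩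
  f (var (proj₁ (occurring eq)))  ≡⟨ cong f (proj₂ (occurring eq)) ⟨
  f m                             ∎
  where
  open VariableWord v
  open ≡-Reasoning

⟨⟩-sub : ∀ {d n N} (v : VariableWord d (fin n) (fin N)) (a : Vec (Fin d) n) (f : ℕ → Fin d) →
         let open VariableWord v in
         (∀ j → f (var j) ≡ Vec.lookup a j) →
         v ⟨ a ⟩ ≡ Vec.tabulate (sub f ∘ word)
⟨⟩-sub v a f f≡a = Vec.tabulate-cong λ t → replace-sub (word t) λ m eq →
  trans (sym (f≡a _)) (cong f (sym (proj₂ (occurring eq))))
  where open VariableWord v

applyUpTo-cong : ∀ {A : Set} {f g : ℕ → A} n → (∀ t → t < n → f t ≡ g t) →
                 applyUpTo f n ≡ applyUpTo g n
applyUpTo-cong zero    f≡g = refl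
applyUpTo-cong (suc n) f≡g =
  cong₂ _∷_ (f≡g 0 z<s) (applyUpTo-cong n λ t t<n → f≡g (suc t) (s<s t<n))

strictly-mono⇒≤ : ∀ (f : ℕ → ℕ) → (∀ {i j} → i < j → f i < f j) → ∀ n → n ≤ f n
strictly-mono⇒≤ f mono zero    = z≤n
strictly-mono⇒≤ f mono (suc n) = ≤-<-trans (strictly-mono⇒≤ f mono n) (mono ≤-refl)

-- Oracle computations

-- The first letter is recovered as a remainder modulo `d`, which is nonzero because the word
-- contains a letter.
codeWord-injective : ∀ {d} {v w : List (Fin d)} → codeWord v ≡ codeWord w → v ≡ w
codeWord-injective {v = []}    {[]}    _  = refl
codeWord-injective {d} {b ∷ v} {b′ ∷ w} eq =
  cong₂ _∷_ b≡b′ (codeWord-injective (*-cancelˡ-≡ _ _ d (+-cancelˡ-≡ (toℕ b) _ _ eq″)))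
  where
  instance _ = nonZeroIndex b
  eq′ : toℕ b + d * codeWord v ≡ toℕ b′ + d * codeWord w
  eq′ = suc-injective eq
  digit : ∀ (a : Fin d) n → (toℕ a + d * n) % d ≡ toℕ a
  digit a n rewrite *-comm d n = trans ([m+kn]%n≡m%n (toℕ a) n d) (m<n⇒m%n≡m (toℕ<n a))
  b≡b′ : b ≡ b′
  b≡b′ = toℕ-injective (trans (sym (digit b _)) (trans (cong (_% d) eq′) (digit b′ _)))
  eq″ : toℕ b + d * codeWord v ≡ toℕ b + d * codeWord w
  eq″ = trans eq′ (cong (λ a → toℕ a + d * codeWord w) (sym b≡b′))

codeWord-surjective : ∀ {d} → Fin d → ∀ n → ∃ λ (w : List (Fin d)) → codeWord w ≡ n
codeWord-surjective {d} b₀ = <-rec _ λ where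
    zero    _   → [] , refl
    (suc n) rec → let w , eq = rec (s≤s (m/n≤m n d)) in n mod d ∷ w , cong suc (begin
      toℕ (n mod d) + d * codeWord w ≡⟨ cong₂ (λ a q → a + d * q) (toℕ-fromℕ< (m%n<n n d)) eq ⟩
      n % d + d * (n / d)            ≡⟨ cong (n % d +_) (*-comm d (n / d)) ⟩
      n % d + n / d * d              ≡⟨ m≡m%n+[m/n]*n n d ⟨
      n                              ∎)
  where
  instance _ = nonZeroIndex b₀
  open ≡-Reasoning

codeSymbol-injective : ∀ {d} {s s′ : Symbol d} → codeSymbol s ≡ codeSymbol s′ → s ≡ s′
codeSymbol-injective {s = letter b} {letter b′} eq = cong letter (toℕ-injective eq)
codeSymbol-injective {d} {letter b} {x m}       eq = ⊥-elim (<⇒≢ (<-≤-trans (toℕ<n b) (m≤m+n d m)) eq)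
codeSymbol-injective {d} {x m} {letter b}       eq = ⊥-elim (<⇒≢ (<-≤-trans (toℕ<n b) (m≤m+n d m)) (sym eq))
codeSymbol-injective {d} {x m} {x m′}           eq = cong x (+-cancelˡ-≡ d m m′ eq)

lookup-injective : ∀ {A : Set} {n} (xs ys : Vec A n) →
                   (∀ i → Vec.lookup xs i ≡ Vec.lookup ys i) → xs ≡ ys
lookup-injective xs ys eq =
  trans (sym (Vec.tabulate∘lookup xs)) (trans (Vec.tabulate-cong eq) (Vec.tabulate∘lookup ys))

module _ {d k} {c : List (Fin d) → Fin k} where

  -- The argument is generalized to `xs` with an equation because `codeWord w` and `codeWord w′`
  -- cannot be unified when two oracle steps are matched.
  ⇓oracle⁻¹ : ∀ {xs y n} → c ⊢ oracle · xs ⇓ y → xs ≡ n ∷ [] →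
              ∃ λ w → codeWord w ≡ n × toℕ (c w) ≡ y
  ⇓oracle⁻¹ (⇓oracle w) refl = w , refl , refl

  ⇓-deterministic : ∀ {n} {p : Rec n} {xs y z} → c ⊢ p · xs ⇓ y → c ⊢ p · xs ⇓ z → y ≡ z
  ⇓-deterministic ⇓zero     ⇓zero     = refl
  ⇓-deterministic ⇓suc      ⇓suc      = refl
  ⇓-deterministic (⇓proj i) (⇓proj _) = refl
  ⇓-deterministic (⇓oracle w) D with w′ , eq , refl ← ⇓oracle⁻¹ D refl =
    cong (toℕ ∘ c) (codeWord-injective (sym eq))
  ⇓-deterministic (⇓comp {ys = ys} Gs F) (⇓comp {ys = ys′} Gs′ F′)
    with refl ← lookup-injective ys ys′ (λ i → ⇓-deterministic (Gs i) (Gs′ i)) = ⇓-deterministic F F′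
  ⇓-deterministic (⇓prec-0 F)   (⇓prec-0 F′)    = ⇓-deterministic F F′
  ⇓-deterministic (⇓prec-s R G) (⇓prec-s R′ G′)
    with refl ← ⇓-deterministic R R′ = ⇓-deterministic G G′
  ⇓-deterministic (⇓μ {i = i} <i F) (⇓μ {i = i′} <i′ F′) with <-cmp i i′
  ... | tri≈ _ i≡i′ _ = i≡i′
  -- At the smaller of the two indices one search requires the value 0 and the other a successor.
  ... | tri< i<i′ _ _ with _ , F″ ← <i′ i i<i′ with () ← ⇓-deterministic F F″
  ... | tri> _ _ i′<i with _ , F″ ← <i i′ i′<i with () ← ⇓-deterministic F″ F′

-- The use of an oracle computation

AgreeBelow : ∀ {d k} → ℕ → (c c′ : List (Fin d) → Fin k) → Set
AgreeBelow L c c′ = ∀ w → length w < L → c w ≡ c′ w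

bounded-choice : ∀ {P : ℕ → ℕ → Set} → (∀ {j L L′} → L ≤ L′ → P j L → P j L′) →
                 ∀ i → (∀ j → j < i → ∃ (P j)) → ∃ λ L → ∀ j → j < i → P j L
bounded-choice up zero    h = 0 , λ _ ()
bounded-choice {P} up (suc i) h =
  let L  , all  = bounded-choice {P} up i λ j j<i → h j (m<n⇒m<1+n j<i)
      L′ , last = h i ≤-refl
  in L ⊔ L′ , λ j j<1+i → case-≤ (all j) last (m<1+n⇒m≤n j<1+i)
  where
  case-≤ : ∀ {j L L′} → (j < i → P j L) → P i L′ → j ≤ i → P j (L ⊔ L′)
  case-≤ {j} {L} {L′} below at j≤i with j ≟ i
  ... | yes refl = up (m≤n⊔m L L′) at
  ... | no  j≢i  = up (m≤m⊔n L L′) (below (≤∧≢⇒< j≤i j≢i))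

bounded-choice-Fin : ∀ {m} {P : Fin m → ℕ → Set} → (∀ {j L L′} → L ≤ L′ → P j L → P j L′) →
                     (∀ j → ∃ (P j)) → ∃ λ L → ∀ j → P j L
bounded-choice-Fin {zero}  up h = 0 , λ ()
bounded-choice-Fin {suc m} {P} up h =
  let L , all = bounded-choice-Fin {P = P ∘ suc} up (h ∘ suc) in
  proj₁ (h zero) ⊔ L , λ where
    zero    → up (m≤m⊔n _ _) (proj₂ (h zero))
    (suc j) → up (m≤n⊔m _ _) (all j)

module _ {d k} {c : List (Fin d) → Fin k} where

  UsesBelow : ∀ {n} → Rec n → Vec ℕ n → ℕ → ℕ → Set
  UsesBelow p xs y L = ∀ {c′} → AgreeBelow L c c′ → c′ ⊢ p · xs ⇓ y

  UsesBelow-≤ : ∀ {n} {p : Rec n} {xs y L L′} → L ≤ L′ → UsesBelow p xs y L → UsesBelow p xs y L′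
  UsesBelow-≤ L≤L′ u agree = u λ w w<L → agree w (<-≤-trans w<L L≤L′)

  -- A halting computation puts finitely many questions to the oracle, so changing `c` on long words
  -- does not affect it.
  use : ∀ {n} {p : Rec n} {xs y} → c ⊢ p · xs ⇓ y → ∃ (UsesBelow p xs y)
  use ⇓zero     = 0 , λ _ → ⇓zero
  use ⇓suc      = 0 , λ _ → ⇓suc
  use (⇓proj i) = 0 , λ _ → ⇓proj i
  use (⇓oracle w) = suc (length w) , λ {c′} agree →
    subst (c′ ⊢ oracle · codeWord w ∷ [] ⇓_) (cong toℕ (sym (agree w ≤-refl))) (⇓oracle w)
  use (⇓comp {gs = gs} {xs} {ys} Gs F) =
    let L  , uG = bounded-choice-Fin
                    {P = λ i → UsesBelow (Vec.lookup gs i) xs (Vec.lookup ys i)}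
                    (λ {i} → UsesBelow-≤ {p = Vec.lookup gs i}) (λ i → use (Gs i))
        L′ , uF = use F
    in L ⊔ L′ , λ agree → ⇓comp
         (λ i → UsesBelow-≤ {p = Vec.lookup gs i} (m≤m⊔n L L′) (uG i) agree)
         (UsesBelow-≤ (m≤n⊔m L L′) uF agree)
  use (⇓prec-0 F) = let L , uF = use F in L , λ agree → ⇓prec-0 (uF agree)
  use (⇓prec-s R G) =
    let L , uR = use R
        L′ , uG = use G
    in L ⊔ L′ , λ agree → ⇓prec-s (UsesBelow-≤ (m≤m⊔n L L′) uR agree) (UsesBelow-≤ (m≤n⊔m L L′) uG agree)
  use (⇓μ {f = f} {xs} {i} <i F) =
    let L , u<i = bounded-choice {λ j L → ∃ λ y → UsesBelow f (j ∷ xs) (suc y) L}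
                    (λ { L≤L′ (y , u) → y , UsesBelow-≤ L≤L′ u }) i use-<i
        L′ , uF = use F
    in L ⊔ L′ , λ agree → ⇓μ
         (λ j j<i → let y , u = u<i j j<i in y , UsesBelow-≤ (m≤m⊔n L L′) u agree)
         (UsesBelow-≤ (m≤n⊔m L L′) uF agree)
    where
    use-<i : ∀ j → j < i → ∃ λ L → ∃ λ y → UsesBelow f (j ∷ xs) (suc y) L
    use-<i j j<i with <i j j<i
    ... | y , G = let L , u = use G in L , y , u

-- Enumeration of the programs

programs : ℕ → ∀ n → List (Rec n)
vectors  : ℕ → ∀ m n → List (Vec (Rec n) m)

basic : ∀ n → List (Rec n)
basic 0 = [ zeroᴿ ]
basic 1 = sucᴿ ∷ oracle ∷ []
basic _ = []

precs : ℕ → ∀ n → List (Rec n)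
precs k zero    = []
precs k (suc n) = cartesianProductWith prec (programs k n) (programs k (2 + n))

-- The bound m < k on the arity of the outer function of a composition keeps the list finite.
compounds : ℕ → ∀ n → List (Rec n)
compounds k n = precs k n ++ List.map μ (programs k (suc n)) ++
  concatMap (λ m → cartesianProductWith comp (programs k m) (vectors k m n)) (upTo k)

programs zero    n = []
programs (suc k) n = basic n ++ List.map proj (allFin n) ++ compounds k n

vectors k zero    n = [ [] ]
vectors k (suc m) n = cartesianProductWith _∷_ (programs k n) (vectors k m n)

private
  -- Membership at all later levels is demanded so that the levels of the parts of a program can be
  -- merged by a maximum.
  Listed : ∀ {n} → Rec n → ℕ → Set
  Listed p k = ∀ {k′} → k ≤ k′ → p ∈ programs k′ _

  in-basic : ∀ {n} {p : Rec n} → p ∈ basic n → Listed p 1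
  in-basic p∈ (s≤s _) = ∈-++⁺ˡ p∈

  in-compounds : ∀ {n} {p : Rec n} k → (∀ {k′} → k ≤ k′ → p ∈ compounds k′ n) → Listed p (suc k)
  in-compounds {n} k p∈ (s≤s k≤k′) =
    ∈-++⁺ʳ (basic n) (∈-++⁺ʳ (List.map proj (allFin n)) (p∈ k≤k′))

programs-complete : ∀ {n} (p : Rec n) → ∃ (Listed p)
vectors-complete  : ∀ {m n} (ps : Vec (Rec n) m) →
                    ∃ λ k → ∀ {k′} → k ≤ k′ → ps ∈ vectors k′ m n

programs-complete zeroᴿ    = 1 , in-basic (here refl)
programs-complete sucᴿ     = 1 , in-basic (here refl)
programs-complete oracle   = 1 , in-basic (there (here refl))
programs-complete {n} (proj i) = 1 , λ { (s≤s _) →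
  ∈-++⁺ʳ (basic n) (∈-++⁺ˡ (∈-map⁺ proj (∈-allFin i))) }
programs-complete {n} (comp {m} f gs) =
  let k₁ , f∈  = programs-complete f
      k₂ , gs∈ = vectors-complete gs
      k        = k₁ ⊔ k₂ ⊔ suc m
  in suc k , in-compounds k λ {k′} k≤k′ →
    ∈-++⁺ʳ (precs k′ n) $ ∈-++⁺ʳ (List.map μ (programs k′ (suc n))) $
    ∈-concatMap⁺ (λ m → cartesianProductWith comp (programs k′ m) (vectors k′ m n)) $
    lose (∈-upTo⁺ (≤-trans (m≤n⊔m (k₁ ⊔ k₂) (suc m)) k≤k′))
      (∈-cartesianProductWith⁺ comp
        (f∈ (≤-trans (≤-trans (m≤m⊔n k₁ k₂) (m≤m⊔n _ (suc m))) k≤k′))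
        (gs∈ (≤-trans (≤-trans (m≤n⊔m k₁ k₂) (m≤m⊔n _ (suc m))) k≤k′)))
programs-complete (prec f g) =
  let k₁ , f∈ = programs-complete f
      k₂ , g∈ = programs-complete g
  in suc (k₁ ⊔ k₂) , in-compounds (k₁ ⊔ k₂) λ k≤k′ →
    ∈-++⁺ˡ (∈-cartesianProductWith⁺ prec
      (f∈ (≤-trans (m≤m⊔n k₁ k₂) k≤k′)) (g∈ (≤-trans (m≤n⊔m k₁ k₂) k≤k′)))
programs-complete {n} (μ f) =
  let k , f∈ = programs-complete f
  in suc k , in-compounds k λ {k′} k≤k′ →
    ∈-++⁺ʳ (precs k′ n) (∈-++⁺ˡ (∈-map⁺ μ (f∈ k≤k′)))

vectors-complete []       = 0 , λ _ → here refl
vectors-complete (p ∷ ps) =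
  let k₁ , p∈  = programs-complete p
      k₂ , ps∈ = vectors-complete ps
  in k₁ ⊔ k₂ , λ k≤k′ → ∈-cartesianProductWith⁺ _∷_
    (p∈ (≤-trans (m≤m⊔n k₁ k₂) k≤k′)) (ps∈ (≤-trans (m≤n⊔m k₁ k₂) k≤k′))

-- Substitution and reading a word along positions

bind : ∀ {d} → (ℕ → Symbol d) → Symbol d → Symbol d
bind ρ (letter b) = letter b
bind ρ (x m)      = ρ m

-- Turns an instance of a renamed or substituted word into an instance of the original word.
sub-bind : ∀ {d} f (ρ : ℕ → Symbol d) s → sub f (bind ρ s) ≡ sub (sub f ∘ ρ) s
sub-bind f ρ (letter b) = refl
sub-bind f ρ (x m)      = refl

pad : ∀ {A : Set} {n} → A → Vec A n → ℕ → A
pad a []       _       = a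
pad a (y ∷ ys) zero    = y
pad a (y ∷ ys) (suc t) = pad a ys t

pad-toℕ : ∀ {A : Set} {n} (a : A) (ys : Vec A n) i → pad a ys (toℕ i) ≡ Vec.lookup ys i
pad-toℕ a (y ∷ ys) zero    = refl
pad-toℕ a (y ∷ ys) (suc i) = pad-toℕ a ys i

pad-applyUpTo : ∀ {A : Set} (a : A) g {t l} → t < l → pad a (Vec.fromList (applyUpTo g l)) t ≡ g t
pad-applyUpTo a g {zero}  {suc l} _         = refl
pad-applyUpTo a g {suc t} {suc l} (s≤s t<l) = pad-applyUpTo a (g ∘ suc) t<l

take-applyUpTo : ∀ {A : Set} (f : ℕ → A) {s r} → s ≤ r → take s (applyUpTo f r) ≡ applyUpTo f s
take-applyUpTo f z≤n       = refl
take-applyUpTo f (s≤s s≤r) = cong (f 0 ∷_) (take-applyUpTo (f ∘ suc) s≤r)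

sum-take-suc : ∀ ns (s : Fin (length ns)) →
               sum (take (suc (toℕ s)) ns) ≡ sum (take (toℕ s) ns) + List.lookup ns s
sum-take-suc (n ∷ ns) zero    = +-comm n 0
sum-take-suc (n ∷ ns) (suc s) = trans (cong (n +_) (sum-take-suc ns s)) (sym (+-assoc n _ _))

sum-take-≤ : ∀ t ns → sum (take t ns) ≤ sum ns
sum-take-≤ zero    ns       = z≤n
sum-take-≤ (suc t) []       = z≤n
sum-take-≤ (suc t) (n ∷ ns) = +-monoʳ-≤ n (sum-take-≤ t ns)

first-occurrence-unique : ∀ {d} {h : ℕ → Symbol d} {m t t′} →
                  IsFirstOccurrence {ℓ = ω} h m t → IsFirstOccurrence {ℓ = ω} h m t′ → t ≡ t′
first-occurrence-unique {t = t} {t′} (ht , <t) (ht′ , <t′) with <-cmp t t′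
... | tri< t<t′ _ _ = ⊥-elim (<t′ t t<t′ ht)
... | tri≈ _ t≡t′ _ = t≡t′
... | tri> _ _ t′<t = ⊥-elim (<t t′ t′<t ht′)

-- A word h read along the positions P, with the variables that start in section
-- s renamed to x₀, x₁, … and all other variables replaced by a letter, is a
-- variable word of the kind that f avoids.
module _ {d k} (b₀ : Fin d) (ns : List ℕ) (f : Vec (Fin d) (sum ns) → Fin k)
         (P : ℕ → ℕ) (P-mono : ∀ {t t′} → t < t′ → t′ < sum ns → P t < P t′)
         (h : ℕ → Symbol d) (s : Fin (length ns)) where

  private
    A = sum (take (toℕ s) ns)
    n = List.lookup ns s

  ¬homogeneous⇒¬constant :
    ¬ SectionallyHomogeneous ns f →
    (∀ j → j < n → ∃ λ m → IsFirstOccurrence {ℓ = ω} h m (P (A + j))) →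
    ¬ Constant (λ (g : ℕ → Fin d) → f (Vec.tabulate λ t → sub g (h (P (toℕ t)))))
  ¬homogeneous⇒¬constant ¬hom firsts const = ¬hom (s , v , sections , v-constant)
    where
    A+n≤ : A + n ≤ sum ns
    A+n≤ = ≤-trans (≤-reflexive (sym (sum-take-suc ns s))) (sum-take-≤ (suc (toℕ s)) ns)

    A+j< : ∀ (j : Fin n) → A + toℕ j < sum ns
    A+j< j = <-≤-trans (+-monoʳ-< A (toℕ<n j)) A+n≤

    m : Fin n → ℕ
    m j = proj₁ (firsts (toℕ j) (toℕ<n j))

    m-first : ∀ j → IsFirstOccurrence {ℓ = ω} h (m j) (P (A + toℕ j))
    m-first j = proj₂ (firsts (toℕ j) (toℕ<n j))

    P-injective : ∀ {t t′} → t < sum ns → t′ < sum ns → P t ≡ P t′ → t ≡ t′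
    P-injective {t} {t′} t< t′< eq with <-cmp t t′
    ... | tri< t<t′ _ _ = ⊥-elim (<⇒≢ (P-mono t<t′ t′<) eq)
    ... | tri≈ _ t≡t′ _ = t≡t′
    ... | tri> _ _ t′<t = ⊥-elim (<⇒≢ (P-mono t′<t t<) (sym eq))

    m-injective : ∀ {i j} → m i ≡ m j → i ≡ j
    m-injective {i} {j} eq = toℕ-injective $ +-cancelˡ-≡ A _ _ $ P-injective (A+j< i) (A+j< j) $
      first-occurrence-unique (subst (λ m → IsFirstOccurrence {ℓ = ω} h m _) eq (m-first i)) (m-first j)

    rename : ℕ → Symbol d
    rename m′ with any? (λ j → m′ ≟ m j)
    ... | yes (j , _) = x (toℕ j)
    ... | no  _       = letter b₀

    rename-m : ∀ j → rename (m j) ≡ x (toℕ j)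
    rename-m j with any? (λ j′ → m j ≟ m j′)
    ... | yes (j′ , eq) = cong (x ∘ toℕ) (sym (m-injective eq))
    ... | no  ∄j        = ⊥-elim (∄j (j , refl))

    rename-x : ∀ σ {m′} → bind rename σ ≡ x m′ → ∃ λ j → σ ≡ x (m j) × m′ ≡ toℕ j
    rename-x (x m″) eq with any? (λ j → m″ ≟ m j)
    rename-x (x m″) refl | yes (j , m″≡) = j , cong x m″≡ , refl

    w : Fin (sum ns) → Symbol d
    w t = bind rename (h (P (toℕ t)))

    start : Fin n → Fin (sum ns)
    start j = fromℕ< (A+j< j)

    toℕ-start : ∀ j → toℕ (start j) ≡ A + toℕ j
    toℕ-start j = toℕ-fromℕ< (A+j< j)

    w-start : ∀ j → w (start j) ≡ x (toℕ j)
    w-start j = begin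
      bind rename (h (P (toℕ (start j)))) ≡⟨ cong (bind rename ∘ h ∘ P) (toℕ-start j) ⟩
      bind rename (h (P (A + toℕ j)))     ≡⟨ cong (bind rename) (proj₁ (m-first j)) ⟩
      rename (m j)                        ≡⟨ rename-m j ⟩
      x (toℕ j)                           ∎
      where open ≡-Reasoning

    -- A symbol `x (toℕ j)` in `w` comes from `m j` in `h`, and `P-mono` would place it before the
    -- first occurrence of `m j` there.
    w-before : ∀ j t → toℕ t < toℕ (start j) → w t ≢ x (toℕ j)
    w-before j t t< eq with rename-x (h (P (toℕ t))) eq
    ... | j′ , ht≡ , j≡j′ rewrite toℕ-start j | toℕ-injective j≡j′ =
      proj₂ (m-first j′) (P (toℕ t)) (P-mono t< (A+j< j′)) ht≡

    v : VariableWord d (fin n) (fin (sum ns))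
    v = record
      { word       = w
      ; var        = toℕ
      ; first      = start
      ; var-mono   = id
      ; first-occ  = λ j → w-start j , w-before j
      ; occurring  = λ {t} eq → let j , _ , m≡j = rename-x (h (P (toℕ t))) eq in j , m≡j
      ; first-mono = λ {i} {j} i<j →
          subst₂ _<_ (sym (toℕ-start i)) (sym (toℕ-start j)) (+-monoʳ-< A i<j)
      }

    sections : ∀ t → (∃ λ j → start j ≡ t) ⇔ InSection ns s (toℕ t)
    sections t = mk⇔ to from
      where
      to : (∃ λ j → start j ≡ t) → InSection ns s (toℕ t)
      to (j , refl) rewrite toℕ-start j | sum-take-suc ns s = m≤m+n A (toℕ j) , +-monoʳ-< A (toℕ<n j)
      from : InSection ns s (toℕ t) → ∃ λ j → start j ≡ t
      from (A≤t , t<) = fromℕ< t∸A<n , toℕ-injective (begin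
        toℕ (start (fromℕ< t∸A<n)) ≡⟨ toℕ-start _ ⟩
        A + toℕ (fromℕ< t∸A<n)     ≡⟨ cong (A +_) (toℕ-fromℕ< t∸A<n) ⟩
        A + (toℕ t ∸ A)            ≡⟨ m+[n∸m]≡n A≤t ⟩
        toℕ t                      ∎)
        where
        open ≡-Reasoning
        t∸A<n : toℕ t ∸ A < n
        t∸A<n = +-cancelˡ-< A _ _
          (subst₂ _<_ (sym (m+[n∸m]≡n A≤t)) (sum-take-suc ns s) t<)

    v-sub : ∀ a → v ⟨ a ⟩ ≡ Vec.tabulate (λ t → sub (sub (pad b₀ a) ∘ rename) (h (P (toℕ t))))
    v-sub a = trans (⟨⟩-sub v a (pad b₀ a) (pad-toℕ b₀ a))
                    (Vec.tabulate-cong λ t → sub-bind (pad b₀ a) rename (h (P (toℕ t))))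

    -- Each instance of `v` is `h` read along `P` under the assignment `sub (pad b₀ a) ∘ rename`,
    -- which `const` covers.
    v-constant : Constant (λ a → f (v ⟨ a ⟩))
    v-constant a a′ = trans (cong f (v-sub a)) (trans (const _ _) (cong f (sym (v-sub a′))))

sum-applyUpTo-suc : ∀ X r → sum (applyUpTo X (suc r)) ≡ sum (applyUpTo X r) + X r
sum-applyUpTo-suc X r = begin
  sum (applyUpTo X (suc r))           ≡⟨ cong sum (applyUpTo-∷ʳ X r) ⟨
  sum (applyUpTo X r ++ [ X r ])      ≡⟨ sum-++ (applyUpTo X r) [ X r ] ⟩
  sum (applyUpTo X r) + (X r + 0)     ≡⟨ cong (sum (applyUpTo X r) +_) (+-identityʳ (X r)) ⟩
  sum (applyUpTo X r) + X r           ∎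
  where open ≡-Reasoning

-- The generic coloring

sum-applyUpTo-mono : ∀ X {r r′} → r ≤ r′ → sum (applyUpTo X r) ≤ sum (applyUpTo X r′)
sum-applyUpTo-mono X {r} {r′} r≤r′ = begin
  sum (applyUpTo X r)           ≡⟨ cong sum (take-applyUpTo X r≤r′) ⟨
  sum (take r (applyUpTo X r′)) ≤⟨ sum-take-≤ r _ ⟩
  sum (applyUpTo X r′)          ∎
  where open ≤-Reasoning

-- Words `a` of the fixed length `n` all truncate at `first n`; this gives the constancy that `Good`
-- refutes.
solution-constant : ∀ {d k} {c : List (Fin d) → Fin k} {v} → IsSolution c v →
  let open VariableWord v in
  ∀ n → Constant (λ (f : ℕ → Fin d) → c (applyUpTo (sub f ∘ word) (first n)))
solution-constant {d} {c = c} {v} sol n f g =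
  trans (cong c (sym (eq f))) (trans (sol (prefix f) (prefix g)) (cong c (eq g)))
  where
  open VariableWord v
  prefix : (ℕ → Fin d) → List (Fin d)
  prefix f = applyUpTo (f ∘ var) n
  eq : ∀ f → v ⟪ prefix f ⟫ ≡ applyUpTo (sub f ∘ word) (first n)
  eq f = trans (⟪⟫-sub v (prefix f) f λ i → sym (lookup-applyUpTo (f ∘ var) n i))
               (cong (λ m → applyUpTo (sub f ∘ word) (first m)) (length-applyUpTo (f ∘ var) n))

module Forcing (em : ExcludedMiddle 0ℓ) {d k} (b₀ : Fin d) (k₀ : Fin k) (X : ℕ → ℕ)
               (ensh : ∀ r → 0 < r → ENSH d k (applyUpTo X r)) where

  Coloring : Set
  Coloring = List (Fin d) → Fin k

  N : ℕ → ℕ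
  N r = sum (applyUpTo X r)

  -- Block s consists of the positions P t with N s ≤ t < N (suc s).
  Good : Coloring → ℕ → (ℕ → ℕ) → ℕ → Set
  Good c r P l = ∀ (h : ℕ → Symbol d) s → s < r →
    (∀ j → j < X s → ∃ λ m → IsFirstOccurrence {ℓ = ω} h m (P (N s + j))) →
    ¬ Constant (λ (g : ℕ → Fin d) → c (applyUpTo (sub g ∘ h) l))

  Good-cong : ∀ c c′ P {r l} → (∀ w → length w ≡ l → c w ≡ c′ w) → Good c r P l → Good c′ r P l
  Good-cong c c′ P {l = l} c≡c′ good h s s<r firsts const = good h s s<r firsts λ f g →
    trans (c≡c′ _ (length-applyUpTo _ l)) (trans (const f g) (sym (c≡c′ _ (length-applyUpTo _ l))))

  blockColoring : ℕ → (ℕ → ℕ) → Coloring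
  -- Without blocks there is nothing to avoid, and `ensh` supplies functions for nonempty sequences
  -- only.
  blockColoring zero    P w = k₀
  blockColoring (suc r) P w =
    proj₁ (ensh (suc r) z<s) (Vec.tabulate λ t → pad b₀ (Vec.fromList w) (P (toℕ t)))

  blockColoring-good : ∀ r {P l} → (∀ {t t′} → t < t′ → t′ < N r → P t < P t′) →
                       (∀ {t} → t < N r → P t < l) → Good (blockColoring r P) r P l
  blockColoring-good (suc r) {P} {l} P-mono P< h s s<r firsts const =
    ¬homogeneous⇒¬constant b₀ ns (proj₁ E) P P-mono h s′ (proj₂ E)
      (λ j j< → subst₂ (λ a j → ∃ λ m → IsFirstOccurrence {ℓ = ω} h m (P (a + j))) A≡ refl
                  (firsts j (subst (j <_) n≡ j<)))
      λ f g → trans (sym (eq f)) (trans (const f g) (eq g))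
    where
    ns = applyUpTo X (suc r)
    E  = ensh (suc r) z<s
    s< : s < length ns
    s< = subst (s <_) (sym (length-applyUpTo X (suc r))) s<r
    s′ = fromℕ< s<
    A≡ : N s ≡ sum (take (toℕ s′) ns)
    A≡ = sym (trans (cong (λ i → sum (take i ns)) (toℕ-fromℕ< s<)) (cong sum (take-applyUpTo X (<⇒≤ s<r))))
    n≡ : List.lookup ns s′ ≡ X s
    n≡ = trans (lookup-applyUpTo X (suc r) s′) (cong X (toℕ-fromℕ< s<))
    eq : ∀ g → blockColoring (suc r) P (applyUpTo (sub g ∘ h) l) ≡
               proj₁ E (Vec.tabulate λ t → sub g (h (P (toℕ t))))
    -- All positions read lie below `l`, so the default letter of `pad` never shows.
    eq g = cong (proj₁ E) (Vec.tabulate-cong λ t → pad-applyUpTo b₀ (sub g ∘ h) (P< (toℕ<n t)))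

  -- Only the values of `color` below `height` are a commitment; those above witness that the
  -- demands of the blocks can be met.
  record Condition : Set where
    field
      height  : ℕ
      color   : Coloring
      blocks  : ℕ
      pos     : ℕ → ℕ
      mono    : ∀ {t t′} → t < t′ → t′ < N blocks → pos t < pos t′
      bounded : ∀ {t} → t < N blocks → pos t < height
      good    : ∀ l → height ≤ l → Good color blocks pos l
  open Condition

  record Satisfies (p : Condition) (c : Coloring) : Set where
    constructor _,_
    field
      agree : AgreeBelow (height p) (color p) c
      good  : ∀ l → height p ≤ l → Good c (blocks p) (pos p) l
  open Satisfies

  self : ∀ p → Satisfies p (color p)
  self p = (λ _ _ → refl) , good p

  Solves : Rec 1 → Coloring → Set
  Solves e c = ∃ λ (v : VariableWord d ω ω) → IsSolution c v ×
    (∀ t → c ⊢ e · t ∷ [] ⇓ codeSymbol (VariableWord.word v t))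

  _≼_ : Condition → Condition → Set
  q ≼ p = ∀ c → Satisfies q c → Satisfies p c

  Excludes : Condition → Rec 1 → Set
  Excludes q e = ∀ {c} → Satisfies q c → ¬ Solves e c

  raise : ∀ p → ∃ λ q → q ≼ p × height p < height q
  raise p = record
    { height = suc (height p) ; color = color p ; blocks = blocks p ; pos = pos p ; mono = mono p
    ; bounded = m<n⇒m<1+n ∘ bounded p ; good = λ l h<l → good p l (<⇒≤ h<l) }
    , (λ c sat → (λ w w< → agree sat w (m<n⇒m<1+n w<)) , good-at sat)
    , ≤-refl
    where
    good-at : ∀ {c} → Satisfies _ c → ∀ l → height p ≤ l → Good c (blocks p) (pos p) l
    good-at {c} sat l h≤l with m≤n⇒m<n∨m≡n h≤l
    ... | inj₁ h<l  = good sat l h<l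
    -- At length `height p` the raised condition freezes the colors, so goodness is inherited from
    -- `color p`.
    ... | inj₂ refl = Good-cong (color p) c (pos p) (λ { w refl → agree sat w ≤-refl }) (good p l ≤-refl)

  -- Adding a block against a program

  module AddBlock (p : Condition) (e : Rec 1) {c} (sat : Satisfies p c) (v : VariableWord d ω ω)
                  (out : ∀ t → c ⊢ e · t ∷ [] ⇓ codeSymbol (VariableWord.word v t)) where
    open VariableWord v

    r = blocks p
    L = height p

    pos′ : ℕ → ℕ
    pos′ t with t <? N r
    ... | yes _ = pos p t
    -- Starting with variable number `L` puts the new block at or above `L`, hence after all old
    -- positions.
    ... | no  _ = first (L + (t ∸ N r))

    pos′-old : ∀ {t} → t < N r → pos′ t ≡ pos p t
    pos′-old {t} t< with t <? N r
    ... | yes _  = refl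
    ... | no  t≮ = ⊥-elim (t≮ t<)

    pos′-new : ∀ j → pos′ (N r + j) ≡ first (L + j)
    pos′-new j with N r + j <? N r
    ... | yes lt = ⊥-elim (m+n≮m (N r) j lt)
    ... | no  _  = cong (first ∘ (L +_)) (m+n∸m≡n (N r) j)

    end : ℕ
    -- The block uses the variables numbered from `L` to just before `L + X r`, so all its positions
    -- lie below `end`.
    end = suc (first (L + X r))

    L≤first : ∀ j → L ≤ first (L + j)
    L≤first j = ≤-trans (m≤m+n L j) (strictly-mono⇒≤ first first-mono (L + j))

    -- Freezing the coloring below `U` preserves the output of `e` at every position below `end`.
    uses : ∃ λ U → ∀ t → t < end → UsesBelow {c = c} e (t ∷ []) (codeSymbol (word t)) U
    uses = bounded-choice {λ t U → UsesBelow {c = c} e (t ∷ []) (codeSymbol (word t)) U}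
             (λ U≤U′ u {_} → UsesBelow-≤ {c = c} U≤U′ u) end λ t _ → use (out t)

    U H : ℕ
    U = proj₁ uses
    H = end ⊔ U

    L<end : L < end
    L<end = s≤s (L≤first (X r))

    L<H : L < H
    L<H = <-≤-trans L<end (m≤m⊔n end U)

    pos′-end : ∀ {t} → t < N (suc r) → pos′ t < end
    pos′-end {t} t< with t <? N r
    ... | yes t<Nr = <-trans (bounded p t<Nr) L<end
    ... | no  t≮Nr = m<n⇒m<1+n (first-mono (+-monoʳ-< L (+-cancelˡ-< (N r) _ _
      (subst₂ _<_ (sym (m+[n∸m]≡n (≮⇒≥ t≮Nr))) (sum-applyUpTo-suc X r) t<))))

    pos′-mono : ∀ {t t′} → t < t′ → t′ < N (suc r) → pos′ t < pos′ t′
    pos′-mono {t} {t′} t<t′ t′< with t <? N r | t′ <? N r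
    ... | yes _  | yes t′<N = mono p t<t′ t′<N
    ... | yes t< | no  _    = <-≤-trans (bounded p t<) (L≤first _)
    ... | no  t≮ | yes t′<N = ⊥-elim (t≮ (<-trans t<t′ t′<N))
    ... | no  t≮ | no  _    = first-mono (+-monoʳ-< L (∸-monoˡ-< t<t′ (≮⇒≥ t≮)))

    color′ : Coloring
    color′ w with length w <? H
    ... | yes _ = c w
    ... | no  _ = blockColoring (suc r) pos′ w

    color′-below : AgreeBelow H color′ c
    color′-below w w< with length w <? H
    ... | yes _  = refl
    ... | no  w≮ = ⊥-elim (w≮ w<)

    color′-above : ∀ w → H ≤ length w → blockColoring (suc r) pos′ w ≡ color′ w
    color′-above w H≤ with length w <? H
    ... | yes w< = ⊥-elim (<⇒≱ w< H≤)
    ... | no  _  = refl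

    q : Condition
    q = record
      { height  = H
      ; color   = color′
      ; blocks  = suc r
      ; pos     = pos′
      ; mono    = pos′-mono
      ; bounded = λ t< → <-≤-trans (pos′-end t<) (m≤m⊔n end U)
      ; good    = λ l H≤l → Good-cong (blockColoring (suc r) pos′) color′ pos′ (λ { w refl → color′-above w H≤l })
                    (blockColoring-good (suc r) pos′-mono
                      λ t< → <-≤-trans (pos′-end t<) (≤-trans (m≤m⊔n end U) H≤l))
      }

    q≼p : q ≼ p
    q≼p _ sat′ =
      (λ w w< → trans (agree sat w w<) (trans (sym (color′-below w (<-trans w< L<H))) (agree sat′ w (<-trans w< L<H))))
      , good′ sat′
      where
      old-block : ∀ {s j} → s < r → j < X s → N s + j < N r
      old-block {s} {j} s<r j< = <-≤-trans (+-monoʳ-< (N s) j<)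
        (≤-trans (≤-reflexive (sym (sum-applyUpTo-suc X s))) (sum-applyUpTo-mono X s<r))
      good′ : ∀ {c′} → Satisfies q c′ → ∀ l → L ≤ l → Good c′ r (pos p) l
      good′ {c′} sat′ l L≤l with l <? H
      -- Between `L` and `H` the colors are those of `c`, which satisfies `p`; from `H` on the old
      -- blocks are among those of `q`, at the same positions.
      ... | yes l<H = Good-cong c c′ (pos p)
                        (λ { w refl → trans (sym (color′-below w l<H)) (agree sat′ w l<H) }) (good sat l L≤l)
      ... | no  l≮H = λ h s s<r firsts → good sat′ l (≮⇒≥ l≮H) h s (m<n⇒m<1+n s<r) λ j j< →
        subst (λ t → ∃ λ m → IsFirstOccurrence {ℓ = ω} h m t) (sym (pos′-old (old-block s<r j<))) (firsts j j<)

    -- On `c′` the program can only output a word that equals `v` below `end`. There the new block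
    -- consists of first occurrences, and `Good` contradicts constancy.
    excludes : Excludes q e
    excludes {c′} sat′ (v′ , sol , out′) =
      -- `first′ H` is a length at which instances of `v′` are truncated and, being at least `H`,
      -- one that `Good` governs.
      good sat′ (first′ H) (strictly-mono⇒≤ first′ (VariableWord.first-mono v′) H) word′ r ≤-refl
        firsts (solution-constant {c = c′} {v = v′} sol H)
      where
      open VariableWord v′ using () renaming (word to word′; first to first′)
      agree′ : AgreeBelow U c c′
      agree′ w w< = let w<H = <-≤-trans w< (m≤n⊔m end U) in
        trans (sym (color′-below w w<H)) (agree sat′ w w<H)
      word≡ : ∀ t → t < end → word t ≡ word′ t
      word≡ t t< = codeSymbol-injective (⇓-deterministic (proj₂ uses t t< agree′) (out′ t))
      firsts : ∀ j → j < X r → ∃ λ m → IsFirstOccurrence {ℓ = ω} word′ m (pos′ (N r + j))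
      firsts j j< rewrite pos′-new j =
        let t<end = m<n⇒m<1+n (first-mono (+-monoʳ-< L j<))
            at , before = first-occ (L + j)
        in var (L + j) , trans (sym (word≡ _ t<end)) at ,
           λ t t< eq → before t t< (trans (word≡ t (<-trans t< t<end)) eq)

  dense : ∀ p e → ∃ λ q → q ≼ p × height p < height q × Excludes q e
  dense p e with em {∃ λ c → Satisfies p c × Solves e c}
  ... | yes (c , sat , v , sol , out) = q , q≼p , L<H , λ {c} → excludes {c}
    where open AddBlock p e sat v out
  ... | no ∄c =
    let q , q≼p , h< = raise p
    in q , q≼p , h< , λ {c} sat solves → ∄c (c , q≼p c sat , solves)

  dense-list : ∀ p es → ∃ λ q → q ≼ p × height p < height q × (∀ {e} → e ∈ es → Excludes q e)
  dense-list p [] = let q , q≼p , h< = raise p in q , q≼p , h< , λ ()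
  dense-list p (e ∷ es) =
    let q  , q≼p , h<  , ex  = dense p e
        q′ , q′≼ , h<′ , ex′ = dense-list q es
    in q′ , (λ c → q≼p c ∘ q′≼ c) , <-trans h< h<′ , λ where
         (here refl) sat → ex (q′≼ _ sat)
         (there e∈)  sat → ex′ e∈ sat

  stage : ℕ → Condition
  stage zero = record
    { height = 0 ; color = const k₀ ; blocks = 0 ; pos = id
    ; mono = λ _ () ; bounded = λ () ; good = λ _ _ _ _ () }
  stage (suc n) = proj₁ (dense-list (stage n) (programs n 1))

  stage-≼ : ∀ {m n} → m ≤ n → stage n ≼ stage m
  stage-≼ {m} {n} m≤n with m≤n⇒m<n∨m≡n m≤n
  stage-≼ {m} {suc n} _ | inj₁ (s≤s m≤n) =
    λ c → stage-≼ m≤n c ∘ proj₁ (proj₂ (dense-list (stage n) (programs n 1))) c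
  stage-≼ {m} {m}     _ | inj₂ refl = λ _ → id

  n≤height : ∀ n → n ≤ height (stage n)
  n≤height zero    = z≤n
  n≤height (suc n) = ≤-<-trans (n≤height n) (proj₁ (proj₂ (proj₂ (dense-list (stage n) (programs n 1)))))

  -- Stage `suc (length w)` has height above `length w`, so the color of `w` no longer changes from
  -- there on.
  limit : Coloring
  limit w = color (stage (suc (length w))) w

  stage-agree : ∀ {m n} w → m ≤ n → length w < height (stage m) → color (stage m) w ≡ color (stage n) w
  stage-agree {n = n} w m≤n w< = agree (stage-≼ m≤n _ (self (stage n))) w w<

  limit-satisfies : ∀ n → Satisfies (stage n) limit
  limit-satisfies n = agree′ , good′
    where
    agree′ : AgreeBelow (height (stage n)) (color (stage n)) limit
    agree′ w w< with ≤-total n (suc (length w))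
    ... | inj₁ n≤ = stage-agree w n≤ w<
    ... | inj₂ n≥ = sym (stage-agree w n≥ (n≤height (suc (length w))))
    good′ : ∀ l → height (stage n) ≤ l → Good limit (blocks (stage n)) (pos (stage n)) l
    -- On words of length `l` the limit is the coloring of stage `suc l`, which is no earlier than
    -- stage `n` and satisfies it.
    good′ l h≤l = Good-cong (color (stage (suc l))) limit (pos (stage n)) (λ { w refl → refl })
      (good (stage-≼ (≤-trans (n≤height n) (m≤n⇒m≤1+n h≤l)) _ (self (stage (suc l)))) l h≤l)

  limit-unsolved : ¬ HasComputableSolution limit
  limit-unsolved (v , sol , e , out) =
    let n , e∈ = programs-complete e
    in proj₂ (proj₂ (proj₂ (dense-list (stage n) (programs n 1)))) (e∈ ≤-refl)
         (limit-satisfies (suc n)) (v , sol , out)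

-- Computable functions

IsLeastZero : (ℕ → ℕ) → ℕ → Set
IsLeastZero f m = f m ≡ 0 × ∀ j → j < m → f j ≢ 0

least-zero : ∀ f n → f n ≡ 0 → ∃ (IsLeastZero f)
least-zero f zero    f0≡0 = 0 , f0≡0 , λ _ ()
least-zero f (suc n) eq with f 0 ≟ 0
... | yes f0≡0 = 0 , f0≡0 , λ _ ()
... | no  f0≢0 = let m , fm≡0 , below = least-zero (f ∘ suc) n eq in
  suc m , fm≡0 , λ { zero _ → f0≢0 ; (suc j) (s≤s j<m) → below j j<m }

least-zero-unique : ∀ {f m m′} → IsLeastZero f m → IsLeastZero f m′ → m ≡ m′
least-zero-unique {f} {m} {m′} (eq , below) (eq′ , below′) with <-cmp m m′
... | tri< m<m′ _ _ = ⊥-elim (below′ m m<m′ eq)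
... | tri≈ _ m≡m′ _ = m≡m′
... | tri> _ _ m′<m = ⊥-elim (below m′ m′<m eq′)

sumTo : (ℕ → ℕ) → ℕ → ℕ
sumTo f zero    = 0
sumTo f (suc n) = f n + sumTo f n

sumTo-cong : ∀ {f g} n → (∀ t → f t ≡ g t) → sumTo f n ≡ sumTo g n
sumTo-cong zero    f≡g = refl
sumTo-cong (suc n) f≡g = cong₂ _+_ (f≡g n) (sumTo-cong n f≡g)

sumTo≡0⁻¹ : ∀ {f n} → sumTo f n ≡ 0 → ∀ t → t < n → f t ≡ 0
sumTo≡0⁻¹ {f} {suc n} eq t t<1+n with m≤n⇒m<n∨m≡n (m<1+n⇒m≤n t<1+n)
... | inj₁ t<n  = sumTo≡0⁻¹ (m+n≡0⇒n≡0 (f n) eq) t t<n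
... | inj₂ refl = m+n≡0⇒m≡0 (f n) eq

sumTo≡0 : ∀ {f} n → (∀ t → t < n → f t ≡ 0) → sumTo f n ≡ 0
sumTo≡0 zero    f≡0 = refl
sumTo≡0 (suc n) f≡0 = cong₂ _+_ (f≡0 n ≤-refl) (sumTo≡0 n λ t t<n → f≡0 t (m<n⇒m<1+n t<n))

infixl 7 _÷_
_÷_ : ℕ → ℕ → ℕ
a ÷ zero    = 0
a ÷ (suc b) = a / suc b

÷≡/ : ∀ a b .{{_ : NonZero b}} → a ÷ b ≡ a / b
÷≡/ a (suc b) = refl

-- The quotient is the least `q` with `a < suc q * b`; the factor `b` makes the search stop at 0
-- when the divisor is 0.
÷-least : ∀ a b → IsLeastZero (λ q → (suc a ∸ suc q * b) * b) (a ÷ b)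
÷-least a zero    = *-zeroʳ (suc a ∸ 0) , λ _ ()
÷-least a (suc b) =
  cong (_* suc b) (m≤n⇒m∸n≡0 {suc a} {suc (a / suc b) * suc b} a<) , λ q q< eq →
    <⇒≱ (s≤s (≤-trans (*-monoˡ-≤ (suc b) q<) (m/n*n≤m a (suc b))))
        (m∸n≡0⇒m≤n (m*n≡0⇒m≡0 (suc a ∸ suc q * suc b) (suc b) eq))
  where
  a< : a < suc (a / suc b) * suc b
  a< = ≤-trans (s≤s (≤-reflexive (m≡m%n+[m/n]*n a (suc b)))) (+-monoˡ-< _ (m%n<n a (suc b)))

opaque
  -- The digit of `e` at place `t` in base `B`, with the remainder spelled out by operations that
  -- have programs.
  digit : ℕ → ℕ → ℕ → ℕ
  digit B e t = e ÷ B ^ t ∸ e ÷ B ^ t ÷ B * B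

  digit-def : ∀ B e t → e ÷ B ^ t ∸ e ÷ B ^ t ÷ B * B ≡ digit B e t
  digit-def B e t = refl

  digit-% : ∀ B e t .{{_ : NonZero B}} → digit B e t ≡ (e ÷ B ^ t) % B
  digit-% B e t = trans (cong (λ r → e ÷ B ^ t ∸ r * B) (÷≡/ (e ÷ B ^ t) B)) (sym (m%n≡m∸m/n*n (e ÷ B ^ t) B))

digit< : ∀ B e t .{{_ : NonZero B}} → digit B e t < B
digit< B e t = subst (_< B) (sym (digit-% B e t)) (m%n<n (e ÷ B ^ t) B)

digit-zero : ∀ {B a} e .{{_ : NonZero B}} → a < B → digit B (a + e * B) 0 ≡ a
digit-zero {B} {a} e a<B = begin
  digit B (a + e * B) 0    ≡⟨ digit-% B (a + e * B) 0 ⟩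
  ((a + e * B) / 1) % B    ≡⟨ cong (_% B) (n/1≡n (a + e * B)) ⟩
  (a + e * B) % B          ≡⟨ [m+kn]%n≡m%n a e B ⟩
  a % B                    ≡⟨ m<n⇒m%n≡m a<B ⟩
  a                        ∎
  where open ≡-Reasoning

digit-suc : ∀ {B a} e t .{{_ : NonZero B}} → a < B → digit B (a + e * B) (suc t) ≡ digit B e t
digit-suc {B} {a} e t a<B = trans (digit-% B (a + e * B) (suc t)) $ trans (cong (_% B) (begin
  (a + e * B) ÷ (B * B ^ t)   ≡⟨ ÷≡/ (a + e * B) (B * B ^ t) ⟩
  (a + e * B) / (B * B ^ t)   ≡⟨ m/n/o≡m/[n*o] (a + e * B) B (B ^ t) ⟨
  (a + e * B) / B / B ^ t     ≡⟨ /-congˡ {o = B ^ t} (+-distrib-/-∣ʳ a (divides-refl e)) ⟩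
  (a / B + e * B / B) / B ^ t ≡⟨ /-congˡ {o = B ^ t} (cong₂ _+_ (m<n⇒m/n≡0 a<B) (m*n/n≡m e B)) ⟩
  e / B ^ t                   ≡⟨ ÷≡/ e (B ^ t) ⟨
  e ÷ B ^ t                   ∎)) (sym (digit-% B e t))
  where
  open ≡-Reasoning
  instance
    _ = m^n≢0 B t
    _ = m*n≢0 B (B ^ t)

-- The bound on `e` allows a bounded sum to run over all assignments of `l` letters.
digits-surjective : ∀ B .{{_ : NonZero B}} (u : ℕ → ℕ) l → (∀ t → u t < B) →
                    ∃ λ e → e < B ^ l × ∀ t → t < l → digit B e t ≡ u t
digits-surjective B u zero    u<B = 0 , s≤s z≤n , λ _ ()
digits-surjective B u (suc l) u<B =
  let e , e< , eq = digits-surjective B (u ∘ suc) l (u<B ∘ suc) in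
  u 0 + e * B , bound e< , λ where
    zero    _         → digit-zero e (u<B 0)
    (suc t) (s≤s t<l) → trans (digit-suc e t (u<B 0)) (eq t t<l)
  where
  open ≤-Reasoning
  bound : ∀ {e} → e < B ^ l → u 0 + e * B < B * B ^ l
  bound {e} e< = begin-strict
    u 0 + e * B <⟨ +-monoˡ-< (e * B) (u<B 0) ⟩
    suc e * B   ≤⟨ *-monoˡ-≤ B e< ⟩
    B ^ l * B   ≡⟨ *-comm (B ^ l) B ⟩
    B * B ^ l   ∎

-- A pairing function and arithmetical tests

opaque
  isqrt-∃ : ∀ z → ∃ (IsLeastZero λ s → suc z ∸ suc s * suc s)
  isqrt-∃ z = least-zero _ z (m≤n⇒m∸n≡0 (m≤m*n (suc z) (suc z)))

  isqrt fstℕ sndℕ : ℕ → ℕ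
  isqrt z = proj₁ (isqrt-∃ z)
  fstℕ z = z ∸ isqrt z * isqrt z
  sndℕ z = isqrt z ∸ fstℕ z

  isqrt-least : ∀ z → IsLeastZero (λ s → suc z ∸ suc s * suc s) (isqrt z)
  isqrt-least z = proj₂ (isqrt-∃ z)

  fstℕ-def : ∀ z → z ∸ isqrt z * isqrt z ≡ fstℕ z
  fstℕ-def z = refl

  sndℕ-def : ∀ z → isqrt z ∸ fstℕ z ≡ sndℕ z
  sndℕ-def z = refl

  pairℕ : ℕ → ℕ → ℕ
  pairℕ a b = (a + b) * (a + b) + a

  -- The code lies between the squares of `a + b` and `suc (a + b)`; knowing the root, one finds `a`
  -- and then `b` by subtraction.
  isqrt-pairℕ : ∀ a b → isqrt (pairℕ a b) ≡ a + b
  isqrt-pairℕ a b = least-zero-unique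
    (proj₂ (isqrt-∃ (pairℕ a b)))
    ( m≤n⇒m∸n≡0 upper
    , λ j j< eq → <⇒≱ (s≤s (≤-trans (*-mono-≤ j< j<) (m≤m+n _ a))) (m∸n≡0⇒m≤n eq))
    where
    upper : suc ((a + b) * (a + b) + a) ≤ suc (a + b) * suc (a + b)
    upper = subst (suc ((a + b) * (a + b) + a) ≤_) (square a b) (m≤m+n _ (a + b + b))
      where
      square : ∀ a b → suc ((a + b) * (a + b) + a) + (a + b + b) ≡ suc (a + b) * suc (a + b)
      square = solve-∀

  fstℕ-pairℕ : ∀ a b → fstℕ (pairℕ a b) ≡ a
  fstℕ-pairℕ a b rewrite isqrt-pairℕ a b = m+n∸m≡n ((a + b) * (a + b)) a

  sndℕ-pairℕ : ∀ a b → sndℕ (pairℕ a b) ≡ b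
  sndℕ-pairℕ a b rewrite fstℕ-pairℕ a b | isqrt-pairℕ a b = m+n∸m≡n a b

-- Vanishes exactly on equal arguments, so a sum of such terms tests a conjunction of equations.
dist : ℕ → ℕ → ℕ
dist a b = (a ∸ b) + (b ∸ a)

dist≡0⁻¹ : ∀ {a b} → dist a b ≡ 0 → a ≡ b
dist≡0⁻¹ {a} {b} eq = ≤-antisym (m∸n≡0⇒m≤n (m+n≡0⇒m≡0 (a ∸ b) eq)) (m∸n≡0⇒m≤n (m+n≡0⇒n≡0 (a ∸ b) eq))

dist≡0 : ∀ {a b} → a ≡ b → dist a b ≡ 0
dist≡0 {a} refl = cong₂ _+_ (n∸n≡0 a) (n∸n≡0 a)

ifZero ifPos : ℕ → ℕ → ℕ
ifZero zero    y = y
ifZero (suc _) y = 0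
ifPos  zero    y = 0
ifPos  (suc _) y = y

codeWord-∷ʳ : ∀ {d} w (b : Fin d) → codeWord (w ∷ʳ b) ≡ suc (toℕ b) * d ^ length w + codeWord w
codeWord-∷ʳ {d} [] b = cong suc (trans (cong (toℕ b +_) (*-zeroʳ d)) (identity (toℕ b)))
  where
  identity : ∀ b → b + 0 ≡ b * 1 + 0
  identity = solve-∀
codeWord-∷ʳ {d} (a ∷ w) b rewrite codeWord-∷ʳ w b = identity (toℕ a) d (toℕ b) (d ^ length w) (codeWord w)
  where
  identity : ∀ a d b p q → suc (a + d * (suc b * p + q)) ≡ suc b * (d * p) + suc (a + d * q)
  identity = solve-∀

-- Appending a letter adds one place value; as a sum over positions the code becomes accessible to
-- `sumF`.
codeWord-applyUpTo : ∀ {d} (g : ℕ → Fin d) l →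
                     codeWord (applyUpTo g l) ≡ sumTo (λ t → suc (toℕ (g t)) * d ^ t) l
codeWord-applyUpTo g zero = refl
codeWord-applyUpTo {d} g (suc l) = begin
  codeWord (applyUpTo g (suc l))  ≡⟨ cong codeWord (applyUpTo-∷ʳ g l) ⟨
  codeWord (applyUpTo g l ∷ʳ g l) ≡⟨ codeWord-∷ʳ (applyUpTo g l) (g l) ⟩
  suc (toℕ (g l)) * d ^ length (applyUpTo g l) + codeWord (applyUpTo g l)
    ≡⟨ cong₂ (λ n q → suc (toℕ (g l)) * d ^ n + q) (length-applyUpTo g l) (codeWord-applyUpTo g l) ⟩
  sumTo (λ t → suc (toℕ (g t)) * d ^ t) (suc l) ∎
  where open ≡-Reasoning

-- An algebra of computable functions

module Computability {d k} (b₀ : Fin d) (c : List (Fin d) → Fin k) where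

  -- A function bundled with a verified program, so that compound terms are computable by
  -- construction.
  record Fun (n : ℕ) : Set where
    field
      ⟦_⟧     : Vec ℕ n → ℕ
      program : Rec n
      correct : ∀ xs → c ⊢ program · xs ⇓ ⟦_⟧ xs
  open Fun public

  var : ∀ {n} → Fin n → Fun n
  var i = record { ⟦_⟧ = λ xs → Vec.lookup xs i ; program = proj i ; correct = λ xs → ⇓proj i }

  call : ∀ {m n} → Fun m → Vec (Fun n) m → Fun n
  call f gs = record
    { ⟦_⟧     = λ xs → ⟦ f ⟧ (Vec.map (λ g → ⟦ g ⟧ xs) gs)
    ; program = comp (program f) (Vec.map program gs)
    ; correct = λ xs → ⇓comp
        (λ i → subst₂ (λ p y → c ⊢ p · xs ⇓ y)
                 (sym (Vec.lookup-map i program gs)) (sym (Vec.lookup-map i (λ g → ⟦ g ⟧ xs) gs))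
                 (correct (Vec.lookup gs i) xs))
        (correct f _)
    }

  convert : ∀ {n} (f : Fun n) (F : Vec ℕ n → ℕ) → (∀ xs → ⟦ f ⟧ xs ≡ F xs) → Fun n
  convert f F f≡F = record
    { ⟦_⟧ = F ; program = program f ; correct = λ xs → subst (c ⊢ program f · xs ⇓_) (f≡F xs) (correct f xs) }

  recursion : ∀ {n} (F : ℕ → Vec ℕ n → ℕ) (f : Fun n) (g : Fun (2 + n)) →
              (∀ xs → ⟦ f ⟧ xs ≡ F 0 xs) → (∀ m xs → ⟦ g ⟧ (m ∷ F m xs ∷ xs) ≡ F (suc m) xs) →
              Fun (suc n)
  recursion F f g f≡ g≡ = record
    { ⟦_⟧ = λ xs → F (Vec.head xs) (Vec.tail xs) ; program = prec (program f) (program g)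
    ; correct = λ { (m ∷ xs) → go m xs } }
    where
    go : ∀ m xs → c ⊢ prec (program f) (program g) · m ∷ xs ⇓ F m xs
    go zero    xs = ⇓prec-0 (subst (c ⊢ _ · _ ⇓_) (f≡ xs) (correct f xs))
    go (suc m) xs = ⇓prec-s (go m xs) (subst (c ⊢ _ · _ ⇓_) (g≡ m xs) (correct g _))

  -- Stated for a single `xs`, since the search in `codeF` is known to succeed only at the codes
  -- actually reached.
  ⇓least : ∀ {n} (f : Fun (suc n)) {xs m} → IsLeastZero (λ y → ⟦ f ⟧ (y ∷ xs)) m →
           c ⊢ μ (program f) · xs ⇓ m
  ⇓least f {xs} (eq , below) = ⇓μ
    (λ j j<m → let instance _ = ≢-nonZero (below j j<m) in
      pred (⟦ f ⟧ (j ∷ xs)) , subst (c ⊢ _ · _ ⇓_) (sym (suc-pred (⟦ f ⟧ (j ∷ xs)))) (correct f _))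
    (subst (c ⊢ _ · _ ⇓_) eq (correct f _))

  minimum : ∀ {n} (f : Fun (suc n)) (F : Vec ℕ n → ℕ) →
            (∀ xs → IsLeastZero (λ y → ⟦ f ⟧ (y ∷ xs)) (F xs)) → Fun n
  minimum f F least = record { ⟦_⟧ = F ; program = μ (program f) ; correct = λ xs → ⇓least f (least xs) }

  sucF : ∀ {n} → Fun n → Fun n
  sucF f = call (record { ⟦_⟧ = suc ∘ Vec.head ; program = sucᴿ ; correct = λ { (_ ∷ []) → ⇓suc } }) (f ∷ [])

  lit : ∀ {n} → ℕ → Fun n
  lit zero    = call (record { ⟦_⟧ = const 0 ; program = zeroᴿ ; correct = λ { [] → ⇓zero } }) []
  lit (suc m) = sucF (lit m)

  ⟦lit⟧ : ∀ {n} m (xs : Vec ℕ n) → ⟦ lit m ⟧ xs ≡ m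
  ⟦lit⟧ zero    xs = refl
  ⟦lit⟧ (suc m) xs = cong suc (⟦lit⟧ m xs)

  const′ : ∀ {n} → ℕ → Fun n
  const′ m = convert (lit m) (const m) (⟦lit⟧ m)

  binary : (F : ℕ → ℕ → ℕ) (f : Fun 1) (g : Fun 3) →
           (∀ y → ⟦ f ⟧ (y ∷ []) ≡ F 0 y) → (∀ m y → ⟦ g ⟧ (m ∷ F m y ∷ y ∷ []) ≡ F (suc m) y) →
           ∀ {n} → Fun n → Fun n → Fun n
  binary F f g f≡ g≡ a b =
    call (recursion (λ m ys → F m (Vec.head ys)) f g (λ { (y ∷ []) → f≡ y }) (λ { m (y ∷ []) → g≡ m y }))
         (a ∷ b ∷ [])

  infixl 6 _⊕_ _⊖_
  infixl 7 _⊗_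
  infixr 8 _↑_
  _⊕_ _⊗_ _⊖_ _↑_ ifZeroF ifPosF : ∀ {n} → Fun n → Fun n → Fun n
  _⊕_ = binary _+_ (var 0F) (sucF (var 1F)) (λ _ → refl) (λ _ _ → refl)
  _⊗_ = binary _*_ (const′ 0) (var 2F ⊕ var 1F) (λ _ → refl) (λ _ _ → refl)
  -- The recursion of `binary` runs on its first argument, here the subtrahend, so the operands are
  -- swapped; likewise for the exponent in `_↑_`.
  a ⊖ b = binary (λ m y → y ∸ m) (var 0F) (predF (var 1F)) (λ _ → refl) (λ m y → pred[m∸n]≡m∸[1+n] y m) b a
    where
    predF : ∀ {n} → Fun n → Fun n
    predF a = binary (λ m _ → pred m) (const′ 0) (var 0F) (λ _ → refl) (λ _ _ → refl) a a
  a ↑ b = binary (λ m y → y ^ m) (const′ 1) (var 2F ⊗ var 1F) (λ _ → refl) (λ _ _ → refl) b a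
  ifZeroF = binary ifZero (var 0F) (const′ 0) (λ _ → refl) (λ _ _ → refl)
  ifPosF  = binary ifPos (const′ 0) (var 2F) (λ _ → refl) (λ _ _ → refl)

  infixl 7 _÷F_
  _÷F_ distF : ∀ {n} → Fun n → Fun n → Fun n
  a ÷F b = call (minimum ((sucF (var 1F) ⊖ sucF (var 0F) ⊗ var 2F) ⊗ var 2F)
                         (λ xs → Vec.lookup xs 0F ÷ Vec.lookup xs 1F)
                         λ { (a ∷ b ∷ []) → ÷-least a b }) (a ∷ b ∷ [])
  distF a b = (a ⊖ b) ⊕ (b ⊖ a)

  isqrtF fstF sndF : ∀ {n} → Fun n → Fun n
  isqrtF a = call (minimum (sucF (var 1F) ⊖ sucF (var 0F) ⊗ sucF (var 0F)) (isqrt ∘ Vec.head)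
                           λ { (z ∷ []) → isqrt-least z }) (a ∷ [])
  fstF a = convert (a ⊖ isqrtF a ⊗ isqrtF a) (fstℕ ∘ ⟦ a ⟧) (fstℕ-def ∘ ⟦ a ⟧)
  sndF a = convert (isqrtF a ⊖ fstF a) (sndℕ ∘ ⟦ a ⟧) (sndℕ-def ∘ ⟦ a ⟧)

  digitF : ∀ {n} → Fun n → Fun n → Fun n → Fun n
  digitF B e t = convert (e ÷F B ↑ t ⊖ e ÷F B ↑ t ÷F B ⊗ B)
    (λ xs → digit (⟦ B ⟧ xs) (⟦ e ⟧ xs) (⟦ t ⟧ xs)) (λ xs → digit-def (⟦ B ⟧ xs) (⟦ e ⟧ xs) (⟦ t ⟧ xs))

  vars : ∀ {m n} → (Fin m → Fin n) → Vec (Fun n) m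
  vars ρ = Vec.tabulate (var ∘ ρ)

  ⟦vars⟧ : ∀ {m n} (ρ : Fin m → Fin n) xs → Vec.map (λ g → ⟦ g ⟧ xs) (vars ρ) ≡ Vec.tabulate (Vec.lookup xs ∘ ρ)
  ⟦vars⟧ ρ xs = sym (Vec.tabulate-∘ (λ g → ⟦ g ⟧ xs) (var ∘ ρ))

  sumF : ∀ {n} → Fun n → Fun (suc n) → Fun n
  sumF {n} bound f = convert
    (call (recursion F (const′ 0) (call f (var 0F ∷ vars shift) ⊕ var 1F)
             (λ _ → refl) λ m xs → cong (λ ys → ⟦ f ⟧ (m ∷ ys) + F m xs)
                                        (trans (⟦vars⟧ shift (m ∷ F m xs ∷ xs)) (Vec.tabulate∘lookup xs)))
          (bound ∷ vars id))
    (λ xs → F (⟦ bound ⟧ xs) xs)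
    (λ xs → cong (F (⟦ bound ⟧ xs)) (trans (⟦vars⟧ id xs) (Vec.tabulate∘lookup xs)))
    where
    shift : Fin n → Fin (2 + n)
    shift i = suc (suc i)
    F : ℕ → Vec ℕ n → ℕ
    F m xs = sumTo (λ t → ⟦ f ⟧ (t ∷ xs)) m

  -- Since `codeWord` is onto, the oracle answers at every number, as `Fun` demands.
  query : ℕ → ℕ
  query m = toℕ (c (proj₁ (codeWord-surjective b₀ m)))

  query-codeWord : ∀ w → query (codeWord w) ≡ toℕ (c w)
  query-codeWord w = cong (toℕ ∘ c) (codeWord-injective (proj₂ (codeWord-surjective b₀ (codeWord w))))

  oracleF : ∀ {n} → Fun n → Fun n
  oracleF a = call (record
    { ⟦_⟧ = query ∘ Vec.head ; program = oracle
    ; correct = λ { (m ∷ []) → let w , eq = codeWord-surjective b₀ m in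
        subst (λ m → c ⊢ oracle · m ∷ [] ⇓ toℕ (c w)) eq (⇓oracle w) } }) (a ∷ [])

-- Computing a solution from extensions

opaque
  symOf : ∀ {d} → ℕ → Symbol d
  symOf {d} s with s <? d
  ... | yes s<d = letter (fromℕ< s<d)
  ... | no  _   = x (s ∸ d)

  codeSymbol-symOf : ∀ {d} s → codeSymbol (symOf {d} s) ≡ s
  codeSymbol-symOf {d} s with s <? d
  ... | yes s<d = toℕ-fromℕ< s<d
  ... | no  s≮d = m+[n∸m]≡n (≮⇒≥ s≮d)

  sub-symOf : ∀ {d} (f : ℕ → Fin d) s {n} → (s < d → n ≡ s) → (d ≤ s → n ≡ toℕ (f (s ∸ d))) →
              n ≡ toℕ (sub f (symOf s))
  sub-symOf {d} f s small large with s <? d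
  ... | yes s<d = trans (small s<d) (sym (toℕ-fromℕ< s<d))
  ... | no  s≮d = large (≮⇒≥ s≮d)

symOf-codeSymbol : ∀ {d} (s : Symbol d) → symOf (codeSymbol s) ≡ s
symOf-codeSymbol s = codeSymbol-injective (codeSymbol-symOf (codeSymbol s))

codeLetter< : ∀ {d} n (b : Fin d) → codeSymbol (letter b) < d + n
codeLetter< n b = <-≤-trans (toℕ<n b) (m≤m+n _ n)

sub-cong : ∀ {d n} {f g : ℕ → Fin d} s → codeSymbol s < d + n → (∀ j → j < n → f j ≡ g j) → sub f s ≡ sub g s
sub-cong {d} (letter b) _  f≡g = refl
sub-cong {d} (x m)      s< f≡g = f≡g m (+-cancelˡ-< d m _ s<)

-- The variable word `w x₀ ⋯ x_{n-1} τ` with all instances colored `i`. The tail `τ` may contain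
-- further variables, so `f` assigns letters to all indices.
record Extension {d k} (c : List (Fin d) → Fin k) (m : ℕ) (w : ℕ → Fin d) (i : Fin k) (n : ℕ) : Set where
  field
    size     : ℕ
    long     : m + n ≤ size
    word     : ℕ → Symbol d
    prefix   : ∀ t → t < m → word t ≡ letter (w t)
    full     : ∀ j → j < n → word (m + j) ≡ x j
    constant : ∀ f → c (applyUpTo (sub f ∘ word) size) ≡ i

module Search {d k} (b₀ : Fin d) (c : List (Fin d) → Fin k) (m : ℕ) (w : ℕ → Fin d) (i : Fin k)
              (extension : ∀ n → Extension c m w i n) where
  open Computability b₀ c

  private instance
    d≢0 : NonZero d
    d≢0 = nonZeroIndex b₀
    d+n≢0 : ∀ {n} → NonZero (d + n)
    d+n≢0 {n} = >-nonZero (<-≤-trans (>-nonZero⁻¹ d) (m≤m+n d n))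

  -- A number z codes a pair of a length and a sequence of digits; with n
  -- variables allowed, the digits have base d + n and are symbol codes.
  len : ℕ → ℕ
  len = fstℕ

  digitAt : ℕ → ℕ → ℕ → ℕ
  digitAt n z = digit (d + n) (sndℕ z)

  symbol : ℕ → ℕ → ℕ → Symbol d
  symbol n z t = symOf (digitAt n z t)

  -- The base `d + n` admits no variable from `x n` on, which makes the `x n` appended next a first
  -- occurrence.
  symbol< : ∀ n z t → codeSymbol (symbol n z t) < d + n
  symbol< n z t = subst (_< d + n) (sym (codeSymbol-symOf _)) (digit< (d + n) (sndℕ z) t)

  encode : ∀ n l (u : ℕ → Symbol d) → (∀ t → codeSymbol (u t) < d + n) →
           ∃ λ z → len z ≡ l × ∀ t → t < l → symbol n z t ≡ u t
  encode n l u u< =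
    let e , _ , eq = digits-surjective (d + n) (codeSymbol ∘ u) l u< in
    pairℕ l e , fstℕ-pairℕ l e , λ t t<l → begin
      symOf (digit (d + n) (sndℕ (pairℕ l e)) t) ≡⟨ cong (λ e → symOf (digit (d + n) e t)) (sndℕ-pairℕ l e) ⟩
      symOf (digit (d + n) e t)                  ≡⟨ cong symOf (eq t t<l) ⟩
      symOf (codeSymbol (u t))                   ≡⟨ symOf-codeSymbol (u t) ⟩
      u t                                        ∎
    where open ≡-Reasoning

  assignment : ℕ → ℕ → Fin d
  assignment a j = fromℕ< (digit< d a j)

  -- One greedy step. Instances are indexed by the numbers below `d ^ suc n`, so that a bounded sum
  -- can test them all.
  Next : ℕ → ℕ → ℕ → Set
  Next n z z′ =
    len z < len z′ ×
    (∀ t → t < len z → symbol (suc n) z′ t ≡ symbol n z t) ×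
    symbol (suc n) z′ (len z) ≡ x n ×
    (∀ a → a < d ^ suc n → c (applyUpTo (sub (assignment a) ∘ symbol (suc n) z′) (len z′)) ≡ i)

  -- The arithmetical form of substituting `assignment a`; the sign of `d ∸ s` tells letters from
  -- variables.
  instanceCode : ℕ → ℕ → ℕ
  instanceCode a s = ifPos (d ∸ s) s + ifZero (d ∸ s) (digit d a (s ∸ d))

  instanceCode-sub : ∀ a s → instanceCode a s ≡ toℕ (sub (assignment a) (symOf s))
  instanceCode-sub a s = sub-symOf (assignment a) s small large
    where
    small : s < d → instanceCode a s ≡ s
    small s<d with d ∸ s in eq
    ... | zero  = ⊥-elim (<⇒≱ s<d (m∸n≡0⇒m≤n eq))
    ... | suc _ = +-identityʳ s
    large : d ≤ s → instanceCode a s ≡ toℕ (assignment a (s ∸ d))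
    large d≤s rewrite m≤n⇒m∸n≡0 d≤s = sym (toℕ-fromℕ< _)

  wordCode : ℕ → ℕ → ℕ → ℕ
  wordCode n z a = sumTo (λ t → suc (instanceCode a (digitAt n z t)) * d ^ t) (len z)

  query-wordCode : ∀ n z a → query (wordCode n z a) ≡ toℕ (c (applyUpTo (sub (assignment a) ∘ symbol n z) (len z)))
  query-wordCode n z a = trans (cong query (trans
    (sumTo-cong (len z) λ t → cong (λ q → suc q * d ^ t) (instanceCode-sub a (digitAt n z t)))
    (sym (codeWord-applyUpTo _ (len z))))) (query-codeWord _)

  digitAtF : ∀ {m} → Fun m → Fun m → Fun m → Fun m
  digitAtF n z t = digitF (const′ d ⊕ n) (sndF z) t

  instanceCodeF : ∀ {m} → Fun m → Fun m → Fun m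
  instanceCodeF a s = ifPosF (const′ d ⊖ s) s ⊕ ifZeroF (const′ d ⊖ s) (digitF (const′ d) a (s ⊖ const′ d))

  -- The arguments are `z′`, `n`, `z`, and each summand tests one clause of `Next`. Every enclosing
  -- `sumF` shifts the indices by one.
  test : Fun 3
  test =
    (sucF (fstF (var 2F)) ⊖ fstF (var 0F)) ⊕
    (sumF (fstF (var 2F)) (distF (digitAtF (sucF (var 2F)) (var 1F) (var 0F)) (digitAtF (var 2F) (var 3F) (var 0F))) ⊕
    (distF (digitAtF (sucF (var 1F)) (var 0F) (fstF (var 2F))) (const′ d ⊕ var 1F) ⊕
     sumF (const′ d ↑ sucF (var 1F)) (distF
       (oracleF (sumF (fstF (var 1F))
         (sucF (instanceCodeF (var 1F) (digitAtF (sucF (var 3F)) (var 2F) (var 0F))) ⊗ const′ d ↑ var 0F)))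
       (const′ (toℕ i)))))

  ⟦test⟧ : ∀ n z z′ → ⟦ test ⟧ (z′ ∷ n ∷ z ∷ []) ≡
    (suc (len z) ∸ len z′) +
    (sumTo (λ t → dist (digitAt (suc n) z′ t) (digitAt n z t)) (len z) +
    (dist (digitAt (suc n) z′ (len z)) (d + n) +
     sumTo (λ a → dist (query (wordCode (suc n) z′ a)) (toℕ i)) (d ^ suc n)))
  ⟦test⟧ n z z′ = refl

  test-complete : ∀ {n z z′} → Next n z z′ → ⟦ test ⟧ (z′ ∷ n ∷ z ∷ []) ≡ 0
  test-complete {n} {z} {z′} (l< , old , new , col) = trans (⟦test⟧ n z z′) (cong₂ _+_ (m≤n⇒m∸n≡0 l<)
    (cong₂ _+_ (sumTo≡0 (len z) λ t t< → dist≡0 (code (old t t<)))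
    (cong₂ _+_ (dist≡0 (trans (sym (codeSymbol-symOf _)) (cong codeSymbol new)))
               (sumTo≡0 (d ^ suc n) λ a a< → dist≡0 (trans (query-wordCode (suc n) z′ a) (cong toℕ (col a a<)))))))
    where
    code : ∀ {s s′} → symOf {d} s ≡ symOf s′ → s ≡ s′
    code {s} {s′} eq = trans (sym (codeSymbol-symOf s)) (trans (cong codeSymbol eq) (codeSymbol-symOf s′))

  test-sound : ∀ {n z z′} → ⟦ test ⟧ (z′ ∷ n ∷ z ∷ []) ≡ 0 → Next n z z′
  test-sound {n} {z} {z′} eq =
    let eq₀ = trans (sym (⟦test⟧ n z z′)) eq
        eq₁ = m+n≡0⇒n≡0 (suc (len z) ∸ len z′) eq₀
        s₁  = sumTo (λ t → dist (digitAt (suc n) z′ t) (digitAt n z t)) (len z)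
        eq₂ = m+n≡0⇒n≡0 s₁ eq₁
        d₂  = dist (digitAt (suc n) z′ (len z)) (d + n)
    in m∸n≡0⇒m≤n (m+n≡0⇒m≡0 (suc (len z) ∸ len z′) eq₀)
     , (λ t t< → cong symOf (dist≡0⁻¹ (sumTo≡0⁻¹ (m+n≡0⇒m≡0 s₁ eq₁) t t<)))
     , trans (cong symOf (dist≡0⁻¹ (m+n≡0⇒m≡0 d₂ eq₂))) (symOf-codeSymbol (x n))
     , λ a a< → toℕ-injective (trans (sym (query-wordCode (suc n) z′ a))
                                     (dist≡0⁻¹ (sumTo≡0⁻¹ (m+n≡0⇒n≡0 d₂ eq₂) a a<)))

  record Valid (n z : ℕ) : Set where
    field
      long     : m ≤ len z
      prefix   : ∀ t → t < m → symbol n z t ≡ letter (w t)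
      constant : ∀ f → c (applyUpTo (sub f ∘ symbol n z) (len z)) ≡ i

  next-valid : ∀ {n z z′} → Valid n z → Next n z z′ → Valid (suc n) z′
  next-valid {n} {z} {z′} v (l< , old , _ , col) = record
    { long     = ≤-trans long (<⇒≤ l<)
    ; prefix   = λ t t<m → trans (old t (<-≤-trans t<m long)) (prefix t t<m)
    ; constant = λ f →
        -- Only the first `suc n` values of `f` matter, and they are the digits of some `a` whose
        -- instance `Next` has checked.
        let a , a< , eq = digits-surjective d (toℕ ∘ f) (suc n) (toℕ<n ∘ f) in
        trans (cong c (applyUpTo-cong (len z′) λ t _ →
                 sub-cong (symbol (suc n) z′ t) (symbol< (suc n) z′ t) λ j j< →
                   toℕ-injective (sym (trans (toℕ-fromℕ< _) (eq j j<)))))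
              (col a a<)
    }
    where open Valid v

  -- Filling all variables of an extension with `b₀` leaves a variable-free word that begins with
  -- `w` and has color `i`.
  initial : ∃ (Valid 0)
  initial = z , record
    { long     = subst (m ≤_) (sym len-z) m≤
    ; prefix   = λ t t<m → trans (z≡u t (<-≤-trans t<m m≤)) (cong (letter ∘ sub (const b₀)) (E.prefix t t<m))
    ; constant = λ f → trans (cong c (trans (cong (applyUpTo _) len-z)
                   (applyUpTo-cong E.size λ t t< → cong (sub f) (z≡u t t<)))) (E.constant (const b₀))
    }
    where
    module E = Extension (extension 0)
    m≤ : m ≤ E.size
    m≤ = ≤-trans (≤-reflexive (sym (+-identityʳ m))) E.long
    enc = encode 0 E.size (letter ∘ sub (const b₀) ∘ E.word) λ t → codeLetter< 0 (sub (const b₀) (E.word t))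
    z = proj₁ enc
    len-z = proj₁ (proj₂ enc)
    z≡u = proj₂ (proj₂ enc)

  -- The coded word followed by x_n, from position m on, is substituted for the
  -- variables x₀, x₁, … of an extension with sufficiently many of them.
  next-exists : ∀ {n z} → Valid n z → ∃ (Next n z)
  next-exists {n} {z} v = z′
    , subst (l <_) (sym len-z′) l<
    , (λ t t<l → trans (z′≡u t (<-trans t<l l<)) (trans (u≡ t (<⇒≤ t<l)) (extended-old t<l)))
    , trans (z′≡u l l<) (trans (u≡ l ≤-refl) extended-new)
    , λ a _ → trans (cong c (trans (cong (applyUpTo _) len-z′) (applyUpTo-cong E.size λ t t< →
                      trans (cong (sub (assignment a)) (z′≡u t t<)) (sub-bind (assignment a) ρ (E.word t)))))
                    (E.constant (sub (assignment a) ∘ ρ))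
    where
    open Valid v
    l = len z
    -- One variable for each position from `m` to `l`: the coded word beyond `w`, and the new `x n`
    -- at `l`.
    module E = Extension (extension (suc (l ∸ m)))

    extended : ℕ → Symbol d
    extended t with t <? l
    ... | yes _ = symbol n z t
    ... | no  _ = x n

    extended-old : ∀ {t} → t < l → extended t ≡ symbol n z t
    extended-old {t} t<l with t <? l
    ... | yes _  = refl
    ... | no t≮l = ⊥-elim (t≮l t<l)

    extended-new : extended l ≡ x n
    extended-new with l <? l
    ... | yes l<l = ⊥-elim (<-irrefl refl l<l)
    ... | no  _   = refl

    extended< : ∀ t → codeSymbol (extended t) < d + suc n
    extended< t with t <? l
    ... | yes _ = <-trans (symbol< n z t) (+-monoʳ-< d ≤-refl)
    ... | no  _ = +-monoʳ-< d ≤-refl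

    -- An index `j` with `m + j` beyond `l` also goes to `x n`, so the tail brings in no variable
    -- after `x n`.
    ρ : ℕ → Symbol d
    ρ j = extended (m + j)

    bind< : ∀ s → codeSymbol (bind ρ s) < d + suc n
    bind< (letter b) = codeLetter< (suc n) b
    bind< (x j)      = extended< (m + j)

    u≡ : ∀ t → t ≤ l → bind ρ (E.word t) ≡ extended t
    u≡ t t≤l with t <? m
    ... | yes t<m = trans (cong (bind ρ) (E.prefix t t<m))
                          (sym (trans (extended-old (<-≤-trans t<m long)) (prefix t t<m)))
    ... | no  t≮m = begin
      bind ρ (E.word t)             ≡⟨ cong (bind ρ ∘ E.word) t≡ ⟨
      bind ρ (E.word (m + (t ∸ m))) ≡⟨ cong (bind ρ) (E.full (t ∸ m) (s≤s (∸-monoˡ-≤ m t≤l))) ⟩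
      extended (m + (t ∸ m))        ≡⟨ cong extended t≡ ⟩
      extended t                    ∎
      where
      open ≡-Reasoning
      t≡ = m+[n∸m]≡n (≮⇒≥ t≮m)

    l< : l < E.size
    l< = ≤-trans (≤-reflexive (sym (trans (+-suc m (l ∸ m)) (cong suc (m+[n∸m]≡n long))))) E.long

    enc = encode (suc n) E.size (bind ρ ∘ E.word) (bind< ∘ E.word)
    z′ = proj₁ enc
    len-z′ = proj₁ (proj₂ enc)
    z′≡u = proj₂ (proj₂ enc)

  next : ∀ {n z} → Valid n z → ∃ (IsLeastZero λ z′ → ⟦ test ⟧ (z′ ∷ n ∷ z ∷ []))
  next v = let z′ , nx = next-exists v in least-zero _ z′ (test-complete nx)

  stage : ∀ n → ∃ (Valid n)
  stage zero    = initial
  stage (suc n) =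
    let z  , v          = stage n
        z′ , test≡0 , _ = next v
    in z′ , next-valid v (test-sound test≡0)

  opaque
    code : ℕ → ℕ
    code n = proj₁ (stage n)

    code-valid : ∀ n → Valid n (code n)
    code-valid n = proj₂ (stage n)

    code-least : ∀ n → IsLeastZero (λ z′ → ⟦ test ⟧ (z′ ∷ n ∷ code n ∷ [])) (code (suc n))
    code-least n = proj₂ (next (proj₂ (stage n)))

  code-next : ∀ n → Next n (code n) (code (suc n))
  code-next n = test-sound (proj₁ (code-least n))

  -- The starting code is a constant built into the program; each later one is found by an unbounded
  -- search that `code-least` shows to halt.
  codeF : Fun 1
  codeF = record { ⟦_⟧ = code ∘ Vec.head ; program = prec (program (const′ {0} (code 0))) (μ (program test))
                 ; correct = λ { (n ∷ []) → go n } }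
    where
    go : ∀ n → c ⊢ prec (program (const′ {0} (code 0))) (μ (program test)) · n ∷ [] ⇓ code n
    go zero    = ⇓prec-0 (correct (const′ (code 0)) [])
    go (suc n) = ⇓prec-s (go n) (⇓least test (code-least n))

  start : ℕ → ℕ
  start n = len (code n)

  start-mono : ∀ {n n′} → n < n′ → start n < start n′
  start-mono {n} {suc n′} n<1+n′ with m≤n⇒m<n∨m≡n (m<1+n⇒m≤n n<1+n′)
  ... | inj₁ n<n′ = <-trans (start-mono n<n′) (proj₁ (code-next n′))
  ... | inj₂ refl = proj₁ (code-next n)

  coherent : ∀ {n n′ t} → n ≤ n′ → t < start n → symbol n′ (code n′) t ≡ symbol n (code n) t
  coherent {n} {n′} n≤n′ t< with m≤n⇒m<n∨m≡n n≤n′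
  coherent {n} {suc n′} _ t< | inj₁ (s≤s n≤n′) =
    trans (proj₁ (proj₂ (code-next n′)) _ (<-≤-trans t< (start-≤ n≤n′))) (coherent n≤n′ t<)
    where
    start-≤ : ∀ {n n′} → n ≤ n′ → start n ≤ start n′
    start-≤ n≤n′ with m≤n⇒m<n∨m≡n n≤n′
    ... | inj₁ n<n′ = <⇒≤ (start-mono n<n′)
    ... | inj₂ refl = ≤-refl
  coherent {n} {n} _ t< | inj₂ refl = refl

  -- `start (suc t)` exceeds `t`, so position `t` is settled by the code numbered `suc t`.
  limit : ℕ → Symbol d
  limit t = symbol (suc t) (code (suc t)) t

  limit-symbol : ∀ n {t} → t < start n → limit t ≡ symbol n (code n) t
  limit-symbol n {t} t< with ≤-total n (suc t)
  ... | inj₁ n≤ = coherent n≤ t<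
  ... | inj₂ n≥ = sym (coherent n≥ (strictly-mono⇒≤ start start-mono (suc t)))

  solution : VariableWord d ω ω
  solution = record
    { word       = limit
    ; var        = id
    ; first      = start
    ; var-mono   = id
    ; first-occ  = λ n →
        trans (limit-symbol (suc n) (proj₁ (code-next n))) (proj₁ (proj₂ (proj₂ (code-next n))))
      -- Before `start n` all symbol codes are below `d + n`, which is the code of `x n`.
      , λ t t< eq → <-irrefl refl (subst (_< d + n)
          (cong codeSymbol (trans (sym (limit-symbol n t<)) eq)) (symbol< n (code n) t))
    ; occurring  = λ {_} {m} _ → m , refl
    ; first-mono = start-mono
    }

  solution-color : ∀ a → c (solution ⟪ a ⟫) ≡ i
  solution-color a = trans
    (cong c (trans (⟪⟫-sub solution a f (λ j → trans (pad-toℕ b₀ (Vec.fromList a) j) (lookup-fromList a j)))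
                   (applyUpTo-cong _ λ t t< → cong (sub f) (limit-symbol (length a) t<))))
    (Valid.constant (code-valid (length a)) f)
    where
    f = pad b₀ (Vec.fromList a)
    lookup-fromList : ∀ {A : Set} (xs : List A) j → Vec.lookup (Vec.fromList xs) j ≡ List.lookup xs j
    lookup-fromList (_ ∷ xs) zero    = refl
    lookup-fromList (_ ∷ xs) (suc j) = lookup-fromList xs j

  limitF : Fun 1
  limitF = digitAtF (sucF (var 0F)) (call codeF (sucF (var 0F) ∷ [])) (var 0F)

  hasComputableSolution : HasComputableSolution c
  hasComputableSolution = solution , (λ a b → trans (solution-color a) (sym (solution-color b)))
    , program limitF , λ t → subst (c ⊢ program limitF · t ∷ [] ⇓_) (sym (codeSymbol-symOf _)) (correct limitF (t ∷ []))

-- The sequence of lengths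

toList-tabulate : ∀ {A : Set} {n} {F : Fin n → A} (g : ℕ → A) →
                  (∀ i → F i ≡ g (toℕ i)) → Vec.toList (Vec.tabulate F) ≡ applyUpTo g n
toList-tabulate {n = zero}  g F≡g = refl
toList-tabulate {n = suc n} g F≡g = cong₂ _∷_ (F≡g zero) (toList-tabulate (g ∘ suc) (F≡g ∘ suc))

-- The tail is settled first, on the interval from `suc A`; its first value, or the upper bound if
-- it is empty, then forces `g zero` down to `A`.
strictly-mono-onto-interval : ∀ {n A} (g : Fin n → ℕ) → (∀ {i j} → toℕ i < toℕ j → g i < g j) →
  (∀ j → A ≤ g j) → (∀ j → g j < A + n) → ∀ j → g j ≡ A + toℕ j
strictly-mono-onto-interval {suc n} {A} g mono lower upper = λ where
    zero    → trans (≤-antisym (m<1+n⇒m≤n (zero< n g mono (upper zero) tail)) (lower zero)) (sym (+-identityʳ A))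
    (suc j) → trans (tail j) (sym (+-suc A (toℕ j)))
  where
  tail : ∀ j → g (suc j) ≡ suc A + toℕ j
  tail = strictly-mono-onto-interval (g ∘ suc) (mono ∘ s≤s)
    (λ j → ≤-<-trans (lower zero) (mono {zero} z<s))
    (λ j → subst (g (suc j) <_) (+-suc A n) (upper (suc j)))
  zero< : ∀ n (g : Fin (suc n) → ℕ) → (∀ {i j} → toℕ i < toℕ j → g i < g j) → g zero < A + suc n →
          (∀ j → g (suc j) ≡ suc A + toℕ j) → g zero < suc A
  zero< zero    g mono g0< tail = subst (g zero <_) (+-comm A 1) g0<
  zero< (suc n) g mono g0< tail = subst (g zero <_) (trans (tail zero) (+-identityʳ (suc A))) (mono z<s)

Extension-≤ : ∀ {d k} {c : List (Fin d) → Fin k} {m w i n n′} → n ≤ n′ → Extension c m w i n′ → Extension c m w i n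
Extension-≤ {m = m} n≤n′ E = record
  { size = size ; long = ≤-trans (+-monoʳ-≤ m n≤n′) long ; word = word ; prefix = prefix
  ; full = λ j j<n → full j (<-≤-trans j<n n≤n′) ; constant = constant }
  where open Extension E

-- The first occurrences fill section `s` in increasing order. So only letters precede the section,
-- and after renaming it reads `x₀ ⋯ x_{n-1}`.
homogeneous⇒extension : ∀ {d k} (b₀ : Fin d) (c : List (Fin d) → Fin k) ns →
  SectionallyHomogeneous ns (c ∘ Vec.toList) →
  ∃ λ (s : Fin (length ns)) → ∃ λ (w : Vec (Fin d) (sum (take (toℕ s) ns))) → ∃ λ i →
    Extension c (sum (take (toℕ s) ns)) (pad b₀ w) i (List.lookup ns s)
homogeneous⇒extension {d} b₀ c ns (s , v , sections , v-constant) =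
  s , w , c (Vec.toList (v ⟨ Vec.replicate n b₀ ⟩)) , record
    { size     = sum ns
    ; long     = A+n≤
    ; word     = h
    ; prefix   = prefix
    ; full     = full
    ; constant = λ f → trans (cong c (instance-word f)) (v-constant (Vec.tabulate (f ∘ toℕ)) (Vec.replicate n b₀))
    }
  where
  open VariableWord v
  A = sum (take (toℕ s) ns)
  n = List.lookup ns s

  A+n≤ : A + n ≤ sum ns
  A+n≤ = ≤-trans (≤-reflexive (sym (sum-take-suc ns s))) (sum-take-≤ (suc (toℕ s)) ns)

  in-section : ∀ j → InSection ns s (toℕ (first j))
  in-section j = Equivalence.to (sections (first j)) (j , refl)

  first≡ : ∀ j → toℕ (first j) ≡ A + toℕ j
  first≡ = strictly-mono-onto-interval (toℕ ∘ first) first-mono (proj₁ ∘ in-section)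
    λ j → subst (toℕ (first j) <_) (sum-take-suc ns s) (proj₂ (in-section j))

  var-injective : ∀ {i j} → var i ≡ var j → i ≡ j
  var-injective {i} {j} eq with <-cmp (toℕ i) (toℕ j)
  ... | tri< i<j _ _ = ⊥-elim (<⇒≢ (var-mono i<j) eq)
  ... | tri≈ _ i≡j _ = toℕ-injective i≡j
  ... | tri> _ _ j<i = ⊥-elim (<⇒≢ (var-mono j<i) (sym eq))

  ρ : ℕ → Symbol d
  ρ m with any? (λ j → m ≟ var j)
  ... | yes (j , _) = x (toℕ j)
  ... | no  _       = letter b₀

  ρ-var : ∀ j → ρ (var j) ≡ x (toℕ j)
  ρ-var j with any? (λ j′ → var j ≟ var j′)
  ... | yes (j′ , eq) = cong (x ∘ toℕ) (sym (var-injective eq))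
  ... | no  ∄j        = ⊥-elim (∄j (j , refl))

  h : ℕ → Symbol d
  h = pad (letter b₀) (Vec.tabulate (bind ρ ∘ word))

  h-toℕ : ∀ t → h (toℕ t) ≡ bind ρ (word t)
  h-toℕ t = trans (pad-toℕ (letter b₀) (Vec.tabulate (bind ρ ∘ word)) t) (Vec.lookup∘tabulate _ t)

  w : Vec (Fin d) A
  w = Vec.tabulate (sub (const b₀) ∘ h ∘ toℕ)

  -- A variable before `A` would precede its own first occurrence, which lies in the section.
  letter-before : ∀ t → toℕ t < A → bind ρ (word t) ≡ letter (sub (const b₀) (bind ρ (word t)))
  letter-before t t<A with word t in eq
  ... | letter b = refl
  ... | x m with j , refl ← occurring eq =
    ⊥-elim (proj₂ (first-occ j) t (<-≤-trans t<A (proj₁ (in-section j))) eq)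

  prefix : ∀ t → t < A → h t ≡ letter (pad b₀ w t)
  prefix t t<A = begin
    h t                                ≡⟨ cong h t≡ ⟨
    h (toℕ t′)                         ≡⟨ h-toℕ t′ ⟩
    bind ρ (word t′)                   ≡⟨ letter-before t′ (subst (_< A) (sym t≡) t<A) ⟩
    letter (sub (const b₀) (bind ρ (word t′)))
      ≡⟨ cong (letter ∘ sub (const b₀)) (trans (sym (h-toℕ t′)) (cong h (trans t≡ (sym (toℕ-fromℕ< t<A))))) ⟩
    letter (sub (const b₀) (h (toℕ (fromℕ< t<A)))) ≡⟨ cong letter (Vec.lookup∘tabulate _ (fromℕ< t<A)) ⟨
    letter (Vec.lookup w (fromℕ< t<A)) ≡⟨ cong letter (pad-toℕ b₀ w (fromℕ< t<A)) ⟨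
    letter (pad b₀ w (toℕ (fromℕ< t<A))) ≡⟨ cong (letter ∘ pad b₀ w) (toℕ-fromℕ< t<A) ⟩
    letter (pad b₀ w t)                ∎
    where
    open ≡-Reasoning
    t<N = <-≤-trans t<A (≤-trans (m≤m+n A n) A+n≤)
    t′  = fromℕ< t<N
    t≡  = toℕ-fromℕ< t<N

  full : ∀ j → j < n → h (A + j) ≡ x j
  full j j<n = begin
    h (A + j)                ≡⟨ cong (h ∘ (A +_)) (toℕ-fromℕ< j<n) ⟨
    h (A + toℕ j′)           ≡⟨ cong h (first≡ j′) ⟨
    h (toℕ (first j′))       ≡⟨ h-toℕ (first j′) ⟩
    bind ρ (word (first j′)) ≡⟨ cong (bind ρ) (proj₁ (first-occ j′)) ⟩
    ρ (var j′)               ≡⟨ ρ-var j′ ⟩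
    x (toℕ j′)               ≡⟨ cong x (toℕ-fromℕ< j<n) ⟩
    x j                      ∎
    where
    open ≡-Reasoning
    j′ = fromℕ< j<n

  instance-word : ∀ f → applyUpTo (sub f ∘ h) (sum ns) ≡ Vec.toList (v ⟨ Vec.tabulate (f ∘ toℕ) ⟩)
  instance-word f = begin
    applyUpTo (sub f ∘ h) (sum ns)
      ≡⟨ toList-tabulate (sub f ∘ h) (λ t → trans (sym (sub-bind f ρ (word t))) (cong (sub f) (sym (h-toℕ t)))) ⟨
    Vec.toList (Vec.tabulate (sub (sub f ∘ ρ) ∘ word))
      ≡⟨ cong Vec.toList (⟨⟩-sub v (Vec.tabulate (f ∘ toℕ)) (sub f ∘ ρ) λ j →
           trans (cong (sub f) (ρ-var j)) (sym (Vec.lookup∘tabulate (f ∘ toℕ) j))) ⟨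
    Vec.toList (v ⟨ Vec.tabulate (f ∘ toℕ) ⟩) ∎
    where open ≡-Reasoning

bounded-choice-Vec : ∀ {d m} {P : Vec (Fin d) m → ℕ → Set} → (∀ {w L L′} → L ≤ L′ → P w L → P w L′) →
                     (∀ w → ∃ (P w)) → ∃ λ L → ∀ w → P w L
bounded-choice-Vec {m = zero} up h = proj₁ (h []) , λ { [] → proj₂ (h []) }
bounded-choice-Vec {m = suc m} {P} up h =
  let L , all = bounded-choice-Fin {P = λ b L → ∀ w → P (b ∷ w) L} (λ L≤L′ p w → up L≤L′ (p w))
                  λ b → bounded-choice-Vec {P = λ w → P (b ∷ w)} up λ w → h (b ∷ w)
  in L , λ { (b ∷ w) → all b w }

module Lengths (em : ExcludedMiddle 0ℓ) {d k} (b₀ : Fin d) (c : List (Fin d) → Fin k)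
               (unsolved : ¬ HasComputableSolution c) where

  -- If extensions existed for every `n`, `Search` would compute a solution from them.
  no-extension : ∀ m w i → ∃ λ n → ¬ Extension c m w i n
  no-extension m w i with em {∃ λ n → ¬ Extension c m w i n}
  ... | yes ∃n = ∃n
  ... | no ∄n  = ⊥-elim (unsolved (Search.hasComputableSolution b₀ c m w i λ n →
    decidable-stable em λ ¬E → ∄n (n , ¬E)))

  no-extension-uniform : ∀ m → ∃ λ n → ∀ (w : Vec (Fin d) m) i → ¬ Extension c m (pad b₀ w) i n
  no-extension-uniform m = bounded-choice-Vec (λ L≤L′ ¬E i E → ¬E i (Extension-≤ L≤L′ E)) λ w →
    bounded-choice-Fin (λ L≤L′ ¬E E → ¬E (Extension-≤ L≤L′ E)) (no-extension m (pad b₀ w))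

  -- The successor makes the lengths positive; `Extension-≤` absorbs it later.
  width : ℕ → ℕ
  width m = suc (proj₁ (no-extension-uniform m))

  -- Each length depends on the sum of the earlier ones, so the recursion is carried out on these
  -- sums.
  total X : ℕ → ℕ
  total zero    = 0
  total (suc r) = total r + width (total r)
  X r = width (total r)

  sum-X : ∀ r → sum (applyUpTo X r) ≡ total r
  sum-X zero    = refl
  sum-X (suc r) = trans (sum-applyUpTo-suc X r) (cong (_+ X r) (sum-X r))

  ensh∞ : ENSH∞ d k X
  ensh∞ = (λ _ → z<s) , λ r _ → c ∘ Vec.toList , ¬homogeneous r
    where
    ¬homogeneous : ∀ r → ¬ SectionallyHomogeneous (applyUpTo X r) (c ∘ Vec.toList)
    -- A homogeneous section extends a word of length `A` by `width A` variables, more than the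
    -- number chosen to rule this out.
    ¬homogeneous r hom with s , w , i , E ← homogeneous⇒extension b₀ c (applyUpTo X r) hom =
      proj₂ (no-extension-uniform A) w i
        (Extension-≤ (≤-trans (n≤1+n _) (≤-reflexive (sym n≡))) E)
      where
      A = sum (take (toℕ s) (applyUpTo X r))
      n≡ : List.lookup (applyUpTo X r) s ≡ width A
      n≡ = trans (lookup-applyUpTo X r s) (cong width (sym (trans
        (cong sum (take-applyUpTo X (<⇒≤ (subst (toℕ s <_) (length-applyUpTo X r) (toℕ<n s))))) (sum-X (toℕ s)))))

theorem3p5 : ExcludedMiddle 0ℓ →
    (d k : ℕ) → .{{_ : NonZero d}} → .{{_ : NonZero k}} →
    (∃ λ (X : ℕ → ℕ) → ENSH∞ d k X) ⇔
    (∃ λ (c : List (Fin d) → Fin k) → ¬ HasComputableSolution c)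
theorem3p5 em d k = mk⇔
  (λ (X , _ , ensh) → let open Forcing em b₀ k₀ X ensh in limit , limit-unsolved)
  (λ (c , unsolved) → let open Lengths em b₀ c unsolved in X , ensh∞)
  where
  b₀ = fromℕ< (>-nonZero⁻¹ d)
  k₀ = fromℕ< (>-nonZero⁻¹ k)
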